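{- Let $p \geq 3$ be fixed. The edge expansion of the Hanoi graph $H_p^n$ satisfies $h(H_p^n) = \Theta\big(((p-2)/p)^n\big)$ as $n \to \infty$.
   Context: The Tower of Hanoi puzzle has $n$ discs $d_1,\dots,d_n$, with $d_i$ larger than $d_j$ whenever $i>j$, and $p$ pegs $[p]=\{1,\dots,p\}$. A configuration is any function $\tau\colon\{d_1,\dots,d_n\}\to[p]$; since no disc may lie on a smaller disc, each such function determines a unique puzzle state. The Hanoi graph $H_p^n$ has the $p^n$ configurations as vertices, and two configurations are adjacent if and only if one is obtained from the other by a single legal move: the topmost disc of some peg is moved onto another peg whose discs (if any) are all larger than it. For a graph $G=(V,E)$ and $S\subseteq V$, let $\partial S=\{(u,v)\in E : u\in S, v\in V\setminus S\}$. The edge expansion of $G$ is $h(G)=\min\{|\partial S|/|S| : S\subseteq V,\ 0<|S|\le |V|/2\}$. -}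

module Defs where

open import Data.Bool using (Bool; true; false; _∧_; not; if_then_else_)
open import Data.Nat as ℕ using (ℕ; zero; suc; _∸_; _<ᵇ_)
open import Data.Fin as Fin using (Fin; toℕ)
open import Data.Vec as Vec using (Vec; []; _∷_; lookup)
open import Data.Vec.Properties using (≡-dec)
open import Data.List as List using (List; []; _∷_; [_]; map; concatMap; length; filterᵇ; foldr; allFin)
open import Data.Bool.ListAction using () renaming (any to anyᵇ; all to allᵇ)
open import Data.Nat.ListAction using (sum)
open import Data.Integer using (+_)
open import Data.Rational as ℚ using (ℚ; 0ℚ; 1ℚ; _/_; _⊓_; _*_)
open import Relation.Nullary.Decidable using (⌊_⌋)

-- A configuration of the Tower of Hanoi with n discs and p pegs:
-- disc d_{i+1} (i : Fin n) sits on peg (lookup τ i).  Discs with larger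
-- index are larger.
Config : ℕ → ℕ → Set
Config p n = Vec (Fin p) n

_==ᶠ_ : ∀ {p} → Fin p → Fin p → Bool
a ==ᶠ b = ⌊ a Fin.≟ b ⌋

_==ᶜ_ : ∀ {p n} → Config p n → Config p n → Bool
τ ==ᶜ σ = ⌊ ≡-dec Fin._≟_ τ σ ⌋


-- σ is obtained from τ by a single legal move of disc k:
-- σ differs from τ exactly at disc k, no smaller disc lies on the peg of
-- disc k in τ (so k is topmost there), and no smaller disc lies on the
-- target peg (so k may be placed there).
moveOf : ∀ {p n} → Config p n → Config p n → Fin n → Bool
moveOf {p} {n} τ σ k =
  not (lookup τ k ==ᶠ lookup σ k)
  ∧ allᵇ (λ j → if toℕ j ℕ.≡ᵇ toℕ k then true else (lookup τ j ==ᶠ lookup σ j)) (allFin n)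
  ∧ allᵇ (λ j → if toℕ j <ᵇ toℕ k
                 then not (lookup τ j ==ᶠ lookup τ k) ∧ not (lookup τ j ==ᶠ lookup σ k)
                 else true) (allFin n)

adj : ∀ {p n} → Config p n → Config p n → Bool
adj {p} {n} τ σ = anyᵇ (moveOf τ σ) (allFin n)

allConfigs : (p n : ℕ) → List (Config p n)
allConfigs p zero = [ [] ]
allConfigs p (suc n) = concatMap (λ v → map (_∷ v) (allFin p)) (allConfigs p n)

-- all sublists (= all subsets of the vertex set, as lists without repetition)
sublists : ∀ {A : Set} → List A → List (List A)
sublists [] = [ [] ]
sublists (x ∷ xs) = let r = sublists xs in r List.++ map (x ∷_) r

memᶜ : ∀ {p n} → Config p n → List (Config p n) → Bool
memᶜ v S = anyᵇ (v ==ᶜ_) S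

boundarySize : (p n : ℕ) → List (Config p n) → ℕ
boundarySize p n S =
  sum (map (λ u → length (filterᵇ (λ v → not (memᶜ v S) ∧ adj u v)
                                  (allConfigs p n))) S)

-- |∂S| / |S| as a rational (only used for nonempty S)
ratio : ℕ → ℕ → ℚ
ratio b zero = 0ℚ
ratio b (suc s) = + b / suc s

minList : ℚ → List ℚ → ℚ
minList d [] = d
minList d (x ∷ xs) = foldr _⊓_ x xs

-- edge expansion h(H_p^n) = min { |∂S|/|S| : S ⊆ V, 0 < |S| ≤ |V|/2 }.
-- (For n = 0 there is no admissible S; the value 0 is then a dummy.)
edgeExpansion : (p n : ℕ) → ℚ
edgeExpansion p n =
  minList 0ℚ
    (map (λ S → ratio (boundarySize p n S) (length S))
      (filterᵇ (λ S → ⌊ 0 ℕ.<? length S ⌋ ∧ ⌊ 2 ℕ.* length S ℕ.≤? p ℕ.^ n ⌋)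
               (sublists (allConfigs p n))))

_^ℚ_ : ℚ → ℕ → ℚ
q ^ℚ zero = 1ℚ
q ^ℚ suc n = q * (q ^ℚ n)

-- the rational (p - 2) / p  (p ≥ 3 in the theorem; value at p = 0 is a dummy)
base : ℕ → ℚ
base zero = 0ℚ
base (suc m) = + (m ∸ 1) / suc m

{-# OPTIONS --safe #-}
-- For f on configurations let E(f) = Σ (f u ∸ f v) over ordered edges (u , v); for the indicator of S it is |∂S|.
-- Splitting by the peg of the largest disc, E(f) is the sum of the energies of the p slices of f and of the
-- contributions of the moves of the largest disc; the latter, between pegs c and d, form a matching on the
-- (p-2)ⁿ⁻¹ configurations of the other discs that avoid c and d.  With q = p - 2:
--
-- * Upper bound: take for S all configurations with the largest disc on a fixed peg.
-- * Lower bound: the sums of f over the configurations avoiding {i,k} and over those avoiding {i,j} differ by at most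
--   2 E(f), with a constant that does not grow with n.  Hence all means over two-peg-avoiding configurations agree up
--   to O(E(f) / qⁿ); by a geometric recursion so does the mean of f over all configurations, and hence the means
--   of the slices.  Summing over the levels yields the L¹ Poincaré inequality Σ |f - mean f| ≤ O((p/q)ⁿ) E(f),
--   which for the indicator of S with |S| ≤ pⁿ/2 is the isoperimetric inequality.
module Submission where

open import Defs
open import Data.Bool using (Bool; true; false; _∧_; _∨_; not; if_then_else_; T; T?)
open import Data.Bool.ListAction using () renaming (all to allᵇ)
open import Data.Bool.Properties using (T-∧; T-≡; ∧-comm)
open import Data.Empty using (⊥-elim)
open import Data.Fin as Fin using (Fin; zero; suc; toℕ; fromℕ; inject₁)
open import Data.Fin.Properties using (toℕ-injective; toℕ-inject₁; toℕ-fromℕ; toℕ<n; fromℕ≢inject₁; inject₁-injective)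
open import Data.Fin.Relation.Unary.Top using (view; ‵fromℕ; ‵inject₁)
open import Data.List using (List; []; _∷_; map; foldr; concatMap; length; filterᵇ; allFin; _++_; cartesianProductWith)
open import Data.List.Properties using (map-cong; map-cong-local; map-++; map-∘; map-tabulate; length-tabulate)
open import Data.List.Membership.Propositional using (_∈_; lose; find)
open import Data.List.Membership.Propositional.Properties using (∈-allFin; ∈-map⁺; ∈-map⁻; ∈-++⁻; ∈-++⁺ˡ; ∈-++⁺ʳ; ∈-filter⁺; ∈-filter⁻; ∈-cartesianProductWith⁺)
open import Data.List.Relation.Unary.All as All using ([]; _∷_)
import Data.List.Relation.Unary.All.Properties as All
open import Data.List.Relation.Unary.AllPairs using ([]; _∷_)
open import Data.List.Relation.Unary.Any as Any using (here; there)
import Data.List.Relation.Unary.Any.Properties as Any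
open import Data.List.Relation.Unary.Unique.Propositional using (Unique)
import Data.List.Relation.Unary.Unique.Propositional.Properties as Unique
open import Data.Nat using (ℕ; _≤_; zero; suc; s≤s; z≤n)
import Data.Nat as ℕ
import Data.Nat.Properties as ℕ
open import Data.Nat.ListAction using (sum)
open import Data.Nat.ListAction.Properties using (sum-++)
open import Data.Nat.Tactic.RingSolver using (solve-∀)
open import Data.Product using (Σ; ∃; _×_; _,_; proj₁; proj₂)
open import Data.Sum using (inj₁; inj₂)
open import Data.Vec using (Vec; []; _∷_; _∷ʳ_; lookup; last)
import Data.Vec.Properties as Vec
open import Function using (_∘_; id)
open import Function.Bundles using (Equivalence)
open import Relation.Nullary using (yes; no; contradiction)
open import Relation.Nullary.Decidable using (⌊_⌋; toWitness; fromWitness)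
open import Relation.Binary.PropositionalEquality

module Energy where
  open import Data.Nat using (_+_; _*_; _∸_; _^_; _<_; _<ᵇ_; _≡ᵇ_; ∣_-_∣; NonZero)
  open import Data.Nat.Properties
  open import Algebra.Properties.CommutativeSemigroup +-commutativeSemigroup using () renaming (interchange to +-interchange)
  open import Algebra.Properties.CommutativeSemigroup *-commutativeSemigroup using () renaming (x∙yz≈y∙xz to *-exchange)

  private variable
    A B : Set
    p n : ℕ

  -- Finite sums of natural numbers and 0-1 indicators

  𝟙 : Bool → ℕ
  𝟙 true  = 1
  𝟙 false = 0

  𝟙-∧ : ∀ a b → 𝟙 (a ∧ b) ≡ 𝟙 a * 𝟙 b
  𝟙-∧ true  b = sym (+-identityʳ _)
  𝟙-∧ false b = refl

  ∑ : List A → (A → ℕ) → ℕ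
  ∑ xs g = sum (map g xs)

  ∑-cong : (xs : List A) {g h : A → ℕ} → (∀ x → g x ≡ h x) → ∑ xs g ≡ ∑ xs h
  ∑-cong xs e = cong sum (map-cong e xs)

  ∑-mono : (xs : List A) {g h : A → ℕ} → (∀ x → g x ≤ h x) → ∑ xs g ≤ ∑ xs h
  ∑-mono []       e = z≤n
  ∑-mono (x ∷ xs) e = +-mono-≤ (e x) (∑-mono xs e)

  ∑-+ : (xs : List A) (g h : A → ℕ) → ∑ xs (λ x → g x + h x) ≡ ∑ xs g + ∑ xs h
  ∑-+ []       g h = refl
  ∑-+ (x ∷ xs) g h = trans (cong (g x + h x +_) (∑-+ xs g h)) (+-interchange (g x) (h x) _ _)

  ∑-*ˡ : (xs : List A) (a : ℕ) (g : A → ℕ) → ∑ xs (λ x → a * g x) ≡ a * ∑ xs g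
  ∑-*ˡ []       a g = sym (*-zeroʳ a)
  ∑-*ˡ (x ∷ xs) a g = trans (cong (a * g x +_) (∑-*ˡ xs a g)) (sym (*-distribˡ-+ a (g x) _))

  ∑-*ʳ : (xs : List A) (a : ℕ) (g : A → ℕ) → ∑ xs (λ x → g x * a) ≡ ∑ xs g * a
  ∑-*ʳ xs a g = trans (∑-cong xs (λ x → *-comm (g x) a)) (trans (∑-*ˡ xs a g) (*-comm a _))

  ∑-const : (xs : List A) (a : ℕ) → ∑ xs (λ _ → a) ≡ length xs * a
  ∑-const []       a = refl
  ∑-const (x ∷ xs) a = cong (a +_) (∑-const xs a)

  ∑-0 : (xs : List A) → ∑ xs (λ _ → 0) ≡ 0
  ∑-0 xs = trans (∑-const xs 0) (*-zeroʳ (length xs))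

  ∑-swap : (xs : List A) (ys : List B) (g : A → B → ℕ) →
           ∑ xs (λ x → ∑ ys (g x)) ≡ ∑ ys (λ y → ∑ xs (λ x → g x y))
  ∑-swap []       ys g = sym (∑-0 ys)
  ∑-swap (x ∷ xs) ys g = trans (cong (∑ ys (g x) +_) (∑-swap xs ys g)) (sym (∑-+ ys (g x) _))

  ∑-map : (h : A → B) (xs : List A) (g : B → ℕ) → ∑ (map h xs) g ≡ ∑ xs (g ∘ h)
  ∑-map h xs g = cong sum (sym (map-∘ xs))

  ∑-concatMap : (h : A → List B) (xs : List A) (g : B → ℕ) →
                ∑ (concatMap h xs) g ≡ ∑ xs (λ x → ∑ (h x) g)
  ∑-concatMap h []       g = refl
  ∑-concatMap h (x ∷ xs) g = begin
    sum (map g (h x ++ concatMap h xs))       ≡⟨ cong sum (map-++ g (h x) _) ⟩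
    sum (map g (h x) ++ map g (concatMap h xs)) ≡⟨ sum-++ (map g (h x)) _ ⟩
    ∑ (h x) g + ∑ (concatMap h xs) g          ≡⟨ cong (∑ (h x) g +_) (∑-concatMap h xs g) ⟩
    ∑ (h x) g + ∑ xs (λ y → ∑ (h y) g)        ∎
    where open ≡-Reasoning

  ∣+-+∣≤ : ∀ a b c d → ∣ a + b - c + d ∣ ≤ ∣ a - c ∣ + ∣ b - d ∣
  ∣+-+∣≤ a b c d = begin
    ∣ a + b - c + d ∣                     ≤⟨ ∣-∣-triangle (a + b) (c + b) (c + d) ⟩
    ∣ a + b - c + b ∣ + ∣ c + b - c + d ∣ ≡⟨ cong₂ _+_ (trans (cong₂ ∣_-_∣ (+-comm a b) (+-comm c b)) (∣m+n-m+o∣≡∣n-o∣ b a c)) (∣m+n-m+o∣≡∣n-o∣ c b d) ⟩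
    ∣ a - c ∣ + ∣ b - d ∣                 ∎
    where open ≤-Reasoning

  ∑-∣-∣ : (xs : List A) (g h : A → ℕ) → ∣ ∑ xs g - ∑ xs h ∣ ≤ ∑ xs (λ x → ∣ g x - h x ∣)
  ∑-∣-∣ []       g h = z≤n
  ∑-∣-∣ (x ∷ xs) g h = ≤-trans (∣+-+∣≤ (g x) _ (h x) _) (+-monoʳ-≤ _ (∑-∣-∣ xs g h))

  ∑-filterᵇ : (P : A → Bool) (xs : List A) → length (filterᵇ P xs) ≡ ∑ xs (𝟙 ∘ P)
  ∑-filterᵇ P [] = refl
  ∑-filterᵇ P (x ∷ xs) with P x
  ... | true  = cong suc (∑-filterᵇ P xs)
  ... | false = ∑-filterᵇ P xs

  -- Sums over pegs and configurations

  ∑ᶜ : (Config p n → ℕ) → ℕ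
  ∑ᶜ {p} {n} = ∑ (allConfigs p n)

  ∑ᶠ : (Fin p → ℕ) → ℕ
  ∑ᶠ {p} = ∑ (allFin p)

  ∑ᶠ-const : ∀ p a → ∑ᶠ {p} (λ _ → a) ≡ p * a
  ∑ᶠ-const p a = trans (∑-const (allFin p) a) (cong (_* a) (length-tabulate {n = p} id))

  ∑ᶠ-suc : (g : Fin (suc p) → ℕ) → ∑ᶠ g ≡ g zero + ∑ᶠ (g ∘ suc)
  ∑ᶠ-suc g = cong (λ l → g zero + sum l) (trans (map-tabulate suc g) (sym (map-tabulate id (g ∘ suc))))

  ==ᶠ-refl : (c : Fin p) → (c ==ᶠ c) ≡ true
  ==ᶠ-refl c with c Fin.≟ c
  ... | yes _ = refl
  ... | no c≢c = contradiction refl c≢c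

  ==ᶠ-≢ : {c d : Fin p} → c ≢ d → (c ==ᶠ d) ≡ false
  ==ᶠ-≢ {c = c} {d} c≢d with c Fin.≟ d
  ... | yes c≡d = contradiction c≡d c≢d
  ... | no _ = refl

  ==ᶠ-suc : (c d : Fin p) → (suc c ==ᶠ suc d) ≡ (c ==ᶠ d)
  ==ᶠ-suc c d with c Fin.≟ d
  ... | yes refl = refl
  ... | no c≢d = refl

  ∑ᶠ-δ : (j : Fin p) (g : Fin p → ℕ) → ∑ᶠ (λ c → 𝟙 (c ==ᶠ j) * g c) ≡ g j
  ∑ᶠ-δ {suc p} zero g = begin
    ∑ᶠ (λ c → 𝟙 (c ==ᶠ zero) * g c) ≡⟨ ∑ᶠ-suc (λ c → 𝟙 (c ==ᶠ zero) * g c) ⟩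
    1 * g zero + ∑ᶠ {p} (λ _ → 0)   ≡⟨ cong₂ _+_ (*-identityˡ (g zero)) (∑-0 (allFin p)) ⟩
    g zero + 0                      ≡⟨ +-identityʳ _ ⟩
    g zero                          ∎
    where open ≡-Reasoning
  ∑ᶠ-δ {suc p} (suc j) g = begin
    ∑ᶠ (λ c → 𝟙 (c ==ᶠ suc j) * g c)       ≡⟨ ∑ᶠ-suc (λ c → 𝟙 (c ==ᶠ suc j) * g c) ⟩
    ∑ᶠ (λ c → 𝟙 (suc c ==ᶠ suc j) * g (suc c)) ≡⟨ ∑-cong (allFin p) (λ c → cong (λ b → 𝟙 b * g (suc c)) (==ᶠ-suc c j)) ⟩
    ∑ᶠ (λ c → 𝟙 (c ==ᶠ j) * g (suc c))     ≡⟨ ∑ᶠ-δ j (g ∘ suc) ⟩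
    g (suc j)                              ∎
    where open ≡-Reasoning

  ∑ᶠ-term : (g : Fin p → ℕ) (j : Fin p) → g j ≤ ∑ᶠ g
  ∑ᶠ-term g j = begin
    g j                         ≡⟨ ∑ᶠ-δ j g ⟨
    ∑ᶠ (λ c → 𝟙 (c ==ᶠ j) * g c) ≤⟨ ∑-mono (allFin _) (λ c → *-monoˡ-≤ (g c) (𝟙≤1 (c ==ᶠ j))) ⟩
    ∑ᶠ (λ c → 1 * g c)          ≡⟨ ∑-cong (allFin _) (λ c → *-identityˡ (g c)) ⟩
    ∑ᶠ g                        ∎
    where
    open ≤-Reasoning
    𝟙≤1 : ∀ b → 𝟙 b ≤ 1
    𝟙≤1 true  = ≤-refl
    𝟙≤1 false = z≤n

  ∑ᶜ-∷ : (f : Config p (suc n) → ℕ) → ∑ᶜ f ≡ ∑ᶜ (λ v → ∑ᶠ (λ c → f (c ∷ v)))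
  ∑ᶜ-∷ {p} {n} f = trans
    (∑-concatMap (λ v → map (_∷ v) (allFin p)) (allConfigs p n) f)
    (∑-cong (allConfigs p n) (λ v → ∑-map (_∷ v) (allFin p) f))

  -- `allConfigs` enumerates by the head, the smallest disc, whereas the recursion of the proof
  -- removes the largest disc, which stands last in the vector. Induction on n carries the split
  -- from one end to the other.
  ∑ᶜ-∷ʳ : (f : Config p (suc n) → ℕ) → ∑ᶜ f ≡ ∑ᶠ (λ c → ∑ᶜ (λ x → f (x ∷ʳ c)))
  ∑ᶜ-∷ʳ {p} {zero} f = begin
    ∑ᶜ f                            ≡⟨ ∑ᶜ-∷ f ⟩
    ∑ᶠ (λ c → f (c ∷ [])) + 0       ≡⟨ +-identityʳ _ ⟩
    ∑ᶠ (λ c → f (c ∷ []))           ≡⟨ ∑-cong (allFin p) (λ c → sym (+-identityʳ (f (c ∷ [])))) ⟩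
    ∑ᶠ (λ c → f (c ∷ []) + 0)       ∎
    where open ≡-Reasoning
  ∑ᶜ-∷ʳ {p} {suc n} f = begin
    ∑ᶜ f                                                   ≡⟨ ∑ᶜ-∷ f ⟩
    ∑ᶜ (λ v → ∑ᶠ (λ d → f (d ∷ v)))                        ≡⟨ ∑ᶜ-∷ʳ (λ v → ∑ᶠ (λ d → f (d ∷ v))) ⟩
    ∑ᶠ (λ c → ∑ᶜ (λ x → ∑ᶠ (λ d → f (d ∷ (x ∷ʳ c)))))      ≡⟨ ∑-cong (allFin p) (λ c → sym (∑ᶜ-∷ (λ y → f (y ∷ʳ c)))) ⟩
    ∑ᶠ (λ c → ∑ᶜ (λ y → f (y ∷ʳ c)))                       ∎
    where open ≡-Reasoning

  ==ᶜ-∷ : (c d : Fin p) (x y : Config p n) → ((c ∷ x) ==ᶜ (d ∷ y)) ≡ ((c ==ᶠ d) ∧ (x ==ᶜ y))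
  ==ᶜ-∷ c d x y with c Fin.≟ d | Vec.≡-dec Fin._≟_ x y
  ... | yes _ | yes _ = refl
  ... | yes _ | no _  = refl
  ... | no _  | _     = refl

  ∑ᶜ-δ : (x : Config p n) (g : Config p n → ℕ) → ∑ᶜ (λ y → 𝟙 (y ==ᶜ x) * g y) ≡ g x
  ∑ᶜ-δ [] g = trans (+-identityʳ _) (+-identityʳ _)
  ∑ᶜ-δ {p} {suc n} (d ∷ x) g = begin
    ∑ᶜ (λ y → 𝟙 (y ==ᶜ (d ∷ x)) * g y)
      ≡⟨ ∑ᶜ-∷ (λ y → 𝟙 (y ==ᶜ (d ∷ x)) * g y) ⟩
    ∑ᶜ (λ y → ∑ᶠ (λ c → 𝟙 ((c ∷ y) ==ᶜ (d ∷ x)) * g (c ∷ y)))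
      ≡⟨ ∑-cong (allConfigs p n) (λ y → ∑-cong (allFin p) (λ c → split c y)) ⟩
    ∑ᶜ (λ y → ∑ᶠ (λ c → 𝟙 (c ==ᶠ d) * (𝟙 (y ==ᶜ x) * g (c ∷ y))))
      ≡⟨ ∑-cong (allConfigs p n) (λ y → ∑ᶠ-δ d (λ c → 𝟙 (y ==ᶜ x) * g (c ∷ y))) ⟩
    ∑ᶜ (λ y → 𝟙 (y ==ᶜ x) * g (d ∷ y))
      ≡⟨ ∑ᶜ-δ x (λ y → g (d ∷ y)) ⟩
    g (d ∷ x) ∎
    where
    open ≡-Reasoning
    split : ∀ c y → 𝟙 ((c ∷ y) ==ᶜ (d ∷ x)) * g (c ∷ y) ≡ 𝟙 (c ==ᶠ d) * (𝟙 (y ==ᶜ x) * g (c ∷ y))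
    split c y = trans (cong (_* g (c ∷ y)) (trans (cong 𝟙 (==ᶜ-∷ c d y x)) (𝟙-∧ (c ==ᶠ d) _))) (*-assoc (𝟙 (c ==ᶠ d)) _ _)

  ∑ᶜ-const : ∀ n a → ∑ᶜ {p} {n} (λ _ → a) ≡ p ^ n * a
  ∑ᶜ-const zero a = refl
  ∑ᶜ-const {p} (suc n) a = begin
    ∑ᶜ {p} {suc n} (λ _ → a)               ≡⟨ ∑ᶜ-∷ʳ {p} {n} (λ _ → a) ⟩
    ∑ᶠ {p} (λ _ → ∑ᶜ {p} {n} (λ _ → a))    ≡⟨ ∑ᶠ-const p _ ⟩
    p * ∑ᶜ {p} {n} (λ _ → a)               ≡⟨ cong (p *_) (∑ᶜ-const n a) ⟩
    p * (p ^ n * a)                        ≡⟨ *-assoc p (p ^ n) a ⟨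
    p ^ suc n * a                          ∎
    where open ≡-Reasoning

  -- Legal moves

  T-⇔⇒≡ : {a b : Bool} → (T a → T b) → (T b → T a) → a ≡ b
  T-⇔⇒≡ {true}  {true}  f g = refl
  T-⇔⇒≡ {true}  {false} f g = ⊥-elim (f _)
  T-⇔⇒≡ {false} {true}  f g = ⊥-elim (g _)
  T-⇔⇒≡ {false} {false} f g = refl

  ==ᶠ⇒≡ : {c d : Fin p} → T (c ==ᶠ d) → c ≡ d
  ==ᶠ⇒≡ = toWitness

  not-==ᶠ⇒≢ : {c d : Fin p} → T (not (c ==ᶠ d)) → c ≢ d
  not-==ᶠ⇒≢ {c = c} t refl = subst (T ∘ not) (==ᶠ-refl c) t

  ≢⇒not-==ᶠ : {c d : Fin p} → c ≢ d → T (not (c ==ᶠ d))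
  ≢⇒not-==ᶠ c≢d = subst (T ∘ not) (sym (==ᶠ-≢ c≢d)) _

  all⇒∀ : (P : Fin n → Bool) → T (allᵇ P (allFin n)) → ∀ j → T (P j)
  all⇒∀ P t j = All.lookup (All.all⁺ P (allFin _) t) (∈-allFin j)

  ∀⇒all : (P : Fin n → Bool) → (∀ j → T (P j)) → T (allᵇ P (allFin n))
  ∀⇒all P t = All.all⁻ P (All.universal t (allFin _))

  record Move (τ σ : Config p n) (k : Fin n) : Set where
    constructor move
    field
      moved : lookup τ k ≢ lookup σ k
      fixed : ∀ j → j ≢ k → lookup τ j ≡ lookup σ j
      free  : ∀ j → toℕ j < toℕ k → lookup τ j ≢ lookup τ k × lookup τ j ≢ lookup σ k

  moveOf⇒Move : (τ σ : Config p n) (k : Fin n) → T (moveOf τ σ k) → Move τ σ k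
  moveOf⇒Move {p} {n} τ σ k t =
    let a , t′ = Equivalence.to T-∧ t
        b , c  = Equivalence.to T-∧ t′
    in move (not-==ᶠ⇒≢ a)
         (λ j j≢k → fixed j j≢k (all⇒∀ _ b j))
         (λ j j<k → free j j<k (all⇒∀ _ c j))
    where
    fixed : ∀ j → j ≢ k → T (if toℕ j ≡ᵇ toℕ k then true else (lookup τ j ==ᶠ lookup σ j)) → lookup τ j ≡ lookup σ j
    fixed j j≢k t with toℕ j ≡ᵇ toℕ k in eq
    ... | true  = contradiction (toℕ-injective (≡ᵇ⇒≡ _ _ (Equivalence.from T-≡ eq))) j≢k
    ... | false = ==ᶠ⇒≡ t
    free : ∀ j → toℕ j < toℕ k →
           T (if toℕ j <ᵇ toℕ k then not (lookup τ j ==ᶠ lookup τ k) ∧ not (lookup τ j ==ᶠ lookup σ k) else true) →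
           lookup τ j ≢ lookup τ k × lookup τ j ≢ lookup σ k
    free j j<k t with toℕ j <ᵇ toℕ k in eq
    ... | true  = let u , v = Equivalence.to T-∧ t in not-==ᶠ⇒≢ u , not-==ᶠ⇒≢ v
    ... | false = ⊥-elim (subst T eq (<⇒<ᵇ j<k))

  Move⇒moveOf : (τ σ : Config p n) (k : Fin n) → Move τ σ k → T (moveOf τ σ k)
  Move⇒moveOf {p} {n} τ σ k (move m fx fr) =
    Equivalence.from T-∧ (≢⇒not-==ᶠ m , Equivalence.from T-∧ (∀⇒all _ fixed , ∀⇒all _ free))
    where
    fixed : ∀ j → T (if toℕ j ≡ᵇ toℕ k then true else (lookup τ j ==ᶠ lookup σ j))
    fixed j with toℕ j ≡ᵇ toℕ k in eq
    ... | true  = _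
    ... | false = fromWitness (fx j λ { refl → subst T eq (≡⇒≡ᵇ (toℕ j) _ refl) })
    free : ∀ j → T (if toℕ j <ᵇ toℕ k then not (lookup τ j ==ᶠ lookup τ k) ∧ not (lookup τ j ==ᶠ lookup σ k) else true)
    free j with toℕ j <ᵇ toℕ k in eq
    ... | true  = let u , v = fr j (<ᵇ⇒< _ _ (Equivalence.from T-≡ eq))
                  in Equivalence.from T-∧ (≢⇒not-==ᶠ u , ≢⇒not-==ᶠ v)
    ... | false = _

  adj⇒Move : (τ σ : Config p n) → T (adj τ σ) → ∃ (Move τ σ)
  adj⇒Move τ σ t = let k , _ , m = find (Any.any⁻ (moveOf τ σ) (allFin _) t) in k , moveOf⇒Move τ σ k m

  Move⇒adj : (τ σ : Config p n) → ∃ (Move τ σ) → T (adj τ σ)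
  Move⇒adj τ σ (k , m) = Any.any⁺ (moveOf τ σ) (lose (∈-allFin k) (Move⇒moveOf τ σ k m))

  lookup-∷ʳ-inject₁ : (x : Vec A n) (c : A) (j : Fin n) → lookup (x ∷ʳ c) (inject₁ j) ≡ lookup x j
  lookup-∷ʳ-inject₁ (a ∷ x) c zero    = refl
  lookup-∷ʳ-inject₁ (a ∷ x) c (suc j) = lookup-∷ʳ-inject₁ x c j

  lookup-∷ʳ-fromℕ : (x : Vec A n) (c : A) → lookup (x ∷ʳ c) (fromℕ n) ≡ c
  lookup-∷ʳ-fromℕ []      c = refl
  lookup-∷ʳ-fromℕ (a ∷ x) c = lookup-∷ʳ-fromℕ x c

  lookup-ext : (x y : Vec A n) → (∀ j → lookup x j ≡ lookup y j) → x ≡ y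
  lookup-ext []      []      e = refl
  lookup-ext (a ∷ x) (b ∷ y) e = cong₂ _∷_ (e zero) (lookup-ext x y (e ∘ suc))

  other : Fin p → Fin p → Fin p → Bool
  other i j c = not (c ==ᶠ i) ∧ not (c ==ᶠ j)

  -- For the discs below the largest one, this is exactly the condition under which the largest disc
  -- may pass between the pegs i and j.
  avoid : Fin p → Fin p → Config p n → Bool
  avoid i j []      = true
  avoid i j (c ∷ x) = other i j c ∧ avoid i j x

  avoid-∷ʳ : (i j c : Fin p) (x : Config p n) → 𝟙 (avoid i j (x ∷ʳ c)) ≡ 𝟙 (other i j c) * 𝟙 (avoid i j x)
  avoid-∷ʳ i j c []      = 𝟙-∧ (other i j c) true
  avoid-∷ʳ i j c (d ∷ x) = begin
    𝟙 (o ∧ avoid i j (x ∷ʳ c))               ≡⟨ 𝟙-∧ o _ ⟩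
    𝟙 o * 𝟙 (avoid i j (x ∷ʳ c))             ≡⟨ cong (𝟙 o *_) (avoid-∷ʳ i j c x) ⟩
    𝟙 o * (𝟙 (other i j c) * 𝟙 (avoid i j x)) ≡⟨ *-exchange (𝟙 o) (𝟙 (other i j c)) _ ⟩
    𝟙 (other i j c) * (𝟙 o * 𝟙 (avoid i j x)) ≡⟨ cong (𝟙 (other i j c) *_) (sym (𝟙-∧ o _)) ⟩
    𝟙 (other i j c) * 𝟙 (o ∧ avoid i j x)     ∎
    where
    open ≡-Reasoning
    o = other i j d

  avoid⇒ : (c d : Fin p) (x : Config p n) → T (avoid c d x) → ∀ j → lookup x j ≢ c × lookup x j ≢ d
  avoid⇒ c d (a ∷ x) t zero    =
    let u , v = Equivalence.to T-∧ (proj₁ (Equivalence.to (T-∧ {other c d a}) t)) in not-==ᶠ⇒≢ u , not-==ᶠ⇒≢ v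
  avoid⇒ c d (a ∷ x) t (suc j) = avoid⇒ c d x (proj₂ (Equivalence.to (T-∧ {other c d a}) t)) j

  ⇒avoid : (c d : Fin p) (x : Config p n) → (∀ j → lookup x j ≢ c × lookup x j ≢ d) → T (avoid c d x)
  ⇒avoid c d []      h = _
  ⇒avoid c d (a ∷ x) h = Equivalence.from T-∧
    ( Equivalence.from T-∧ (≢⇒not-==ᶠ (proj₁ (h zero)) , ≢⇒not-==ᶠ (proj₂ (h zero)))
    , ⇒avoid c d x (h ∘ suc))

  -- A largest disc that stays put obstructs no smaller disc, so legality is decided by x and y
  -- alone; `inject₁` matches the disc indices.
  adj-∷ʳ-same : (c : Fin p) (x y : Config p n) → adj (x ∷ʳ c) (y ∷ʳ c) ≡ adj x y
  adj-∷ʳ-same {p} {n} c x y = T-⇔⇒≡ (Move⇒adj x y ∘ to ∘ adj⇒Move _ _) (Move⇒adj _ _ ∘ from ∘ adj⇒Move x y)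
    where
    lx = lookup-∷ʳ-inject₁ x c
    ly = lookup-∷ʳ-inject₁ y c
    to : ∃ (Move (x ∷ʳ c) (y ∷ʳ c)) → ∃ (Move x y)
    to (k , m) with view k
    ... | ‵fromℕ = contradiction (trans (lookup-∷ʳ-fromℕ x c) (sym (lookup-∷ʳ-fromℕ y c))) (Move.moved m)
    ... | ‵inject₁ k = k , move
      (λ e → Move.moved m (trans (lx k) (trans e (sym (ly k)))))
      (λ j j≢k → trans (sym (lx j)) (trans (Move.fixed m (inject₁ j) (j≢k ∘ inject₁-injective)) (ly j)))
      (λ j j<k →
        let u , v = Move.free m (inject₁ j) (subst₂ _<_ (sym (toℕ-inject₁ j)) (sym (toℕ-inject₁ k)) j<k)
        in (λ e → u (trans (lx j) (trans e (sym (lx k))))) , (λ e → v (trans (lx j) (trans e (sym (ly k))))))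
    from : ∃ (Move x y) → ∃ (Move (x ∷ʳ c) (y ∷ʳ c))
    from (k , m) = inject₁ k , move
      (λ e → Move.moved m (trans (sym (lx k)) (trans e (ly k))))
      fixed
      free
      where
      fixed : ∀ j → j ≢ inject₁ k → lookup (x ∷ʳ c) j ≡ lookup (y ∷ʳ c) j
      fixed j j≢k with view j
      ... | ‵fromℕ = trans (lookup-∷ʳ-fromℕ x c) (sym (lookup-∷ʳ-fromℕ y c))
      ... | ‵inject₁ j = trans (lx j) (trans (Move.fixed m j (j≢k ∘ cong inject₁)) (sym (ly j)))
      free : ∀ j → toℕ j < toℕ (inject₁ k) →
             lookup (x ∷ʳ c) j ≢ lookup (x ∷ʳ c) (inject₁ k) × lookup (x ∷ʳ c) j ≢ lookup (y ∷ʳ c) (inject₁ k)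
      free j j<k with view j
      ... | ‵fromℕ = contradiction (toℕ<n k) (<-asym (subst₂ _<_ (toℕ-fromℕ n) (toℕ-inject₁ k) j<k))
      ... | ‵inject₁ j =
        let u , v = Move.free m j (subst₂ _<_ (toℕ-inject₁ j) (toℕ-inject₁ k) j<k)
        in (λ e → u (trans (sym (lx j)) (trans e (lx k)))) , (λ e → v (trans (sym (lx j)) (trans e (ly k))))

  -- The largest disc changes pegs, so it is the one disc moved: the others must agree, and none of
  -- them may lie on c or d.
  adj-∷ʳ-diff : {c d : Fin p} → c ≢ d → (x y : Config p n) → adj (x ∷ʳ c) (y ∷ʳ d) ≡ ((y ==ᶜ x) ∧ avoid c d x)
  adj-∷ʳ-diff {p} {n} {c} {d} c≢d x y = T-⇔⇒≡ (to ∘ adj⇒Move _ _) (Move⇒adj _ _ ∘ from)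
    where
    lx = lookup-∷ʳ-inject₁ x c
    ly = lookup-∷ʳ-inject₁ y d
    to : ∃ (Move (x ∷ʳ c) (y ∷ʳ d)) → T ((y ==ᶜ x) ∧ avoid c d x)
    to (k , m) with view k
    ... | ‵inject₁ k = contradiction
      (trans (sym (lookup-∷ʳ-fromℕ x c)) (trans (Move.fixed m (fromℕ n) fromℕ≢inject₁) (lookup-∷ʳ-fromℕ y d))) c≢d
    ... | ‵fromℕ = Equivalence.from T-∧
      ( fromWitness (lookup-ext y x (λ j →
          trans (sym (ly j)) (trans (sym (Move.fixed m (inject₁ j) (fromℕ≢inject₁ ∘ sym))) (lx j))))
      , ⇒avoid c d x (λ j →
          let u , v = Move.free m (inject₁ j) (subst₂ _<_ (sym (toℕ-inject₁ j)) (sym (toℕ-fromℕ n)) (toℕ<n j))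
          in (λ e → u (trans (lx j) (trans e (sym (lookup-∷ʳ-fromℕ x c)))))
           , (λ e → v (trans (lx j) (trans e (sym (lookup-∷ʳ-fromℕ y d)))))))
    from : T ((y ==ᶜ x) ∧ avoid c d x) → ∃ (Move (x ∷ʳ c) (y ∷ʳ d))
    from t with Equivalence.to (T-∧ {y ==ᶜ x}) t
    ... | y≡x , av with toWitness y≡x
    ... | refl = fromℕ n , move
      (λ e → c≢d (trans (sym (lookup-∷ʳ-fromℕ x c)) (trans e (lookup-∷ʳ-fromℕ x d))))
      fixed
      free
      where
      fixed : ∀ j → j ≢ fromℕ n → lookup (x ∷ʳ c) j ≡ lookup (x ∷ʳ d) j
      fixed j j≢n with view j
      ... | ‵fromℕ = contradiction refl j≢n
      ... | ‵inject₁ j = trans (lx j) (sym (ly j))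
      free : ∀ j → toℕ j < toℕ (fromℕ n) →
             lookup (x ∷ʳ c) j ≢ lookup (x ∷ʳ c) (fromℕ n) × lookup (x ∷ʳ c) j ≢ lookup (x ∷ʳ d) (fromℕ n)
      free j j<n with view j
      ... | ‵fromℕ = contradiction j<n (<-irrefl refl)
      ... | ‵inject₁ j =
        let u , v = avoid⇒ c d x av j
        in (λ e → u (trans (sym (lx j)) (trans e (lookup-∷ʳ-fromℕ x c))))
         , (λ e → v (trans (sym (lx j)) (trans e (lookup-∷ʳ-fromℕ x d))))

  -- Energy

  -- Truncation keeps only the downward difference, so an undirected edge, met in both orientations,
  -- contributes |f u - f v| once in total.
  energy : (Config p n → ℕ) → ℕ
  energy f = ∑ᶜ (λ u → ∑ᶜ (λ v → 𝟙 (adj u v) * (f u ∸ f v)))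

  slice : Fin p → (Config p (suc n) → ℕ) → Config p n → ℕ
  slice c f x = f (x ∷ʳ c)

  -- The total drop of f along the moves of the largest disc from c to d; the rises along the same
  -- moves are the drops in `bundle f d c`.
  bundle : (Config p (suc n) → ℕ) → Fin p → Fin p → ℕ
  bundle f c d = 𝟙 (not (c ==ᶠ d)) * ∑ᶜ (λ x → 𝟙 (avoid c d x) * (slice c f x ∸ slice d f x))

  cross : (Config p (suc n) → ℕ) → ℕ
  cross f = ∑ᶠ (λ c → ∑ᶠ (λ d → bundle f c d))

  -- Both ends of an edge are split by the peg of the largest disc. Being an equality, it lets later
  -- estimates spend each slice energy and `cross f` without losing a factor per level.
  energy-∷ʳ : (f : Config p (suc n) → ℕ) → energy f ≡ ∑ᶠ (λ c → energy (slice c f)) + cross f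
  energy-∷ʳ {p} {n} f = begin
    energy f
      ≡⟨ ∑ᶜ-∷ʳ (λ u → ∑ᶜ (λ v → 𝟙 (adj u v) * (f u ∸ f v))) ⟩
    ∑ᶠ (λ c → ∑ᶜ (λ x → ∑ᶜ (λ v → 𝟙 (adj (x ∷ʳ c) v) * (f (x ∷ʳ c) ∸ f v))))
      ≡⟨ ∑-cong (allFin p) perPeg ⟩
    ∑ᶠ (λ c → energy (slice c f) + ∑ᶠ (bundle f c))
      ≡⟨ ∑-+ (allFin p) (λ c → energy (slice c f)) (λ c → ∑ᶠ (bundle f c)) ⟩
    ∑ᶠ (λ c → energy (slice c f)) + cross f ∎
    where
    open ≡-Reasoning
    term : Fin p → Config p n → Fin p → Config p n → ℕ
    term c x d y = 𝟙 (adj (x ∷ʳ c) (y ∷ʳ d)) * (slice c f x ∸ slice d f y)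
    inner : Fin p → Config p n → ℕ
    inner c x = ∑ᶜ (λ y → 𝟙 (adj x y) * (slice c f x ∸ slice c f y))
    outer : Fin p → Fin p → Config p n → ℕ
    outer c d x = 𝟙 (avoid c d x) * (slice c f x ∸ slice d f x)
    -- If d = c, the neighbours are those of x among the smaller discs; otherwise there is at most
    -- one, which `∑ᶜ-δ` picks out.
    split : ∀ c x d → ∑ᶜ (term c x d) ≡ 𝟙 (d ==ᶠ c) * inner c x + 𝟙 (not (c ==ᶠ d)) * outer c d x
    split c x d with c Fin.≟ d
    ... | yes refl rewrite ==ᶠ-refl c = begin
      ∑ᶜ (term c x c)   ≡⟨ ∑-cong (allConfigs p n) (λ y → cong (λ b → 𝟙 b * (slice c f x ∸ slice c f y)) (adj-∷ʳ-same c x y)) ⟩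
      inner c x         ≡⟨ *-identityˡ (inner c x) ⟨
      1 * inner c x     ≡⟨ +-identityʳ _ ⟨
      1 * inner c x + 0 ∎
    ... | no c≢d rewrite ==ᶠ-≢ (c≢d ∘ sym) = begin
      ∑ᶜ (term c x d)
        ≡⟨ ∑-cong (allConfigs p n) (λ y → trans
             (cong (_* (slice c f x ∸ slice d f y)) (trans (cong 𝟙 (adj-∷ʳ-diff c≢d x y)) (𝟙-∧ (y ==ᶜ x) (avoid c d x))))
             (*-assoc (𝟙 (y ==ᶜ x)) _ _)) ⟩
      ∑ᶜ (λ y → 𝟙 (y ==ᶜ x) * (𝟙 (avoid c d x) * (slice c f x ∸ slice d f y)))
        ≡⟨ ∑ᶜ-δ x (λ y → 𝟙 (avoid c d x) * (slice c f x ∸ slice d f y)) ⟩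
      outer c d x
        ≡⟨ +-identityʳ _ ⟨
      1 * outer c d x ∎
    perVertex : ∀ c x → ∑ᶜ (λ v → 𝟙 (adj (x ∷ʳ c) v) * (f (x ∷ʳ c) ∸ f v)) ≡
                        inner c x + ∑ᶠ (λ d → 𝟙 (not (c ==ᶠ d)) * outer c d x)
    perVertex c x = begin
      ∑ᶜ (λ v → 𝟙 (adj (x ∷ʳ c) v) * (f (x ∷ʳ c) ∸ f v))
        ≡⟨ ∑ᶜ-∷ʳ (λ v → 𝟙 (adj (x ∷ʳ c) v) * (f (x ∷ʳ c) ∸ f v)) ⟩
      ∑ᶠ (λ d → ∑ᶜ (term c x d))
        ≡⟨ ∑-cong (allFin p) (split c x) ⟩
      ∑ᶠ (λ d → 𝟙 (d ==ᶠ c) * inner c x + 𝟙 (not (c ==ᶠ d)) * outer c d x)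
        ≡⟨ ∑-+ (allFin p) (λ d → 𝟙 (d ==ᶠ c) * inner c x) (λ d → 𝟙 (not (c ==ᶠ d)) * outer c d x) ⟩
      ∑ᶠ (λ d → 𝟙 (d ==ᶠ c) * inner c x) + ∑ᶠ (λ d → 𝟙 (not (c ==ᶠ d)) * outer c d x)
        ≡⟨ cong (_+ ∑ᶠ (λ d → 𝟙 (not (c ==ᶠ d)) * outer c d x)) (∑ᶠ-δ c (λ _ → inner c x)) ⟩
      inner c x + ∑ᶠ (λ d → 𝟙 (not (c ==ᶠ d)) * outer c d x) ∎
    perPeg : ∀ c → ∑ᶜ (λ x → ∑ᶜ (λ v → 𝟙 (adj (x ∷ʳ c) v) * (f (x ∷ʳ c) ∸ f v))) ≡
                   energy (slice c f) + ∑ᶠ (bundle f c)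
    perPeg c = begin
      ∑ᶜ (λ x → ∑ᶜ (λ v → 𝟙 (adj (x ∷ʳ c) v) * (f (x ∷ʳ c) ∸ f v)))
        ≡⟨ ∑-cong (allConfigs p n) (perVertex c) ⟩
      ∑ᶜ (λ x → inner c x + ∑ᶠ (λ d → 𝟙 (not (c ==ᶠ d)) * outer c d x))
        ≡⟨ ∑-+ (allConfigs p n) (inner c) (λ x → ∑ᶠ (λ d → 𝟙 (not (c ==ᶠ d)) * outer c d x)) ⟩
      energy (slice c f) + ∑ᶜ (λ x → ∑ᶠ (λ d → 𝟙 (not (c ==ᶠ d)) * outer c d x))
        ≡⟨ cong (energy (slice c f) +_) (∑-swap (allConfigs p n) (allFin p) (λ x d → 𝟙 (not (c ==ᶠ d)) * outer c d x)) ⟩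
      energy (slice c f) + ∑ᶠ (λ d → ∑ᶜ (λ x → 𝟙 (not (c ==ᶠ d)) * outer c d x))
        ≡⟨ cong (energy (slice c f) +_) (∑-cong (allFin p) (λ d → ∑-*ˡ (allConfigs p n) (𝟙 (not (c ==ᶠ d))) (outer c d))) ⟩
      energy (slice c f) + ∑ᶠ (bundle f c) ∎

  ∑-energy-slice≤ : (f : Config p (suc n) → ℕ) → ∑ᶠ (λ c → energy (slice c f)) ≤ energy f
  ∑-energy-slice≤ f = ≤-trans (m≤m+n _ (cross f)) (≤-reflexive (sym (energy-∷ʳ f)))

  energy-slice≤ : (f : Config p (suc n) → ℕ) (c : Fin p) → energy (slice c f) ≤ energy f
  energy-slice≤ f c = ≤-trans (∑ᶠ-term (λ c → energy (slice c f)) c) (∑-energy-slice≤ f)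

  cross≤energy : (f : Config p (suc n) → ℕ) → cross f ≤ energy f
  cross≤energy f = ≤-trans (m≤n+m (cross f) _) (≤-reflexive (sym (energy-∷ʳ f)))

  -- Sums over the configurations avoiding two pegs

  W : Fin p → Fin p → (Config p n → ℕ) → ℕ
  W i j f = ∑ᶜ (λ x → 𝟙 (avoid i j x) * f x)

  other-comm : (i j c : Fin p) → other i j c ≡ other j i c
  other-comm i j c = ∧-comm (not (c ==ᶠ i)) (not (c ==ᶠ j))

  avoid-comm : (i j : Fin p) (x : Config p n) → avoid i j x ≡ avoid j i x
  avoid-comm i j []      = refl
  avoid-comm i j (c ∷ x) = cong₂ _∧_ (other-comm i j c) (avoid-comm i j x)

  W-comm : (i j : Fin p) (f : Config p n → ℕ) → W i j f ≡ W j i f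
  W-comm i j f = ∑-cong (allConfigs _ _) (λ x → cong (λ b → 𝟙 b * f x) (avoid-comm i j x))

  W-∷ʳ : (i j : Fin p) (f : Config p (suc n) → ℕ) → W i j f ≡ ∑ᶠ (λ c → 𝟙 (other i j c) * W i j (slice c f))
  W-∷ʳ {p} {n} i j f = begin
    W i j f
      ≡⟨ ∑ᶜ-∷ʳ (λ x → 𝟙 (avoid i j x) * f x) ⟩
    ∑ᶠ (λ c → ∑ᶜ (λ x → 𝟙 (avoid i j (x ∷ʳ c)) * f (x ∷ʳ c)))
      ≡⟨ ∑-cong (allFin p) (λ c → ∑-cong (allConfigs p n) (λ x →
           trans (cong (_* f (x ∷ʳ c)) (avoid-∷ʳ i j c x)) (*-assoc (𝟙 (other i j c)) _ _))) ⟩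
    ∑ᶠ (λ c → ∑ᶜ (λ x → 𝟙 (other i j c) * (𝟙 (avoid i j x) * f (x ∷ʳ c))))
      ≡⟨ ∑-cong (allFin p) (λ c → ∑-*ˡ (allConfigs p n) (𝟙 (other i j c)) (λ x → 𝟙 (avoid i j x) * f (x ∷ʳ c))) ⟩
    ∑ᶠ (λ c → 𝟙 (other i j c) * W i j (slice c f)) ∎
    where open ≡-Reasoning

  ∣m-n∣≡m∸n+n∸m : ∀ m n → ∣ m - n ∣ ≡ (m ∸ n) + (n ∸ m)
  ∣m-n∣≡m∸n+n∸m zero    zero    = refl
  ∣m-n∣≡m∸n+n∸m zero    (suc n) = refl
  ∣m-n∣≡m∸n+n∸m (suc m) zero    = sym (+-identityʳ _)
  ∣m-n∣≡m∸n+n∸m (suc m) (suc n) = ∣m-n∣≡m∸n+n∸m m n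

  -- Both sums run over the same x, and a move of the largest disc joins their x-th terms. The
  -- factor 2 stands for the two directions, each bounded by `cross f`.
  W-transfer : {c d : Fin p} → c ≢ d → (f : Config p (suc n) → ℕ) →
               ∣ W c d (slice c f) - W c d (slice d f) ∣ ≤ 2 * cross f
  W-transfer {p} {n} {c} {d} c≢d f = begin
    ∣ W c d (slice c f) - W c d (slice d f) ∣
      ≤⟨ ∑-∣-∣ (allConfigs p n) (λ x → a x * slice c f x) (λ x → a x * slice d f x) ⟩
    ∑ᶜ (λ x → ∣ a x * slice c f x - a x * slice d f x ∣)
      ≡⟨ ∑-cong (allConfigs p n) (λ x → trans (sym (*-distribˡ-∣-∣ (a x) _ _))
           (trans (cong (a x *_) (∣m-n∣≡m∸n+n∸m (slice c f x) _)) (*-distribˡ-+ (a x) _ _))) ⟩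
    ∑ᶜ (λ x → a x * (slice c f x ∸ slice d f x) + a x * (slice d f x ∸ slice c f x))
      ≡⟨ ∑-+ (allConfigs p n) _ _ ⟩
    ∑ᶜ (λ x → a x * (slice c f x ∸ slice d f x)) + ∑ᶜ (λ x → a x * (slice d f x ∸ slice c f x))
      ≡⟨ cong₂ _+_ (bundle≡ c≢d)
           (trans (∑-cong (allConfigs p n) (λ x → cong (λ b → 𝟙 b * (slice d f x ∸ slice c f x)) (avoid-comm c d x)))
                  (bundle≡ (c≢d ∘ sym))) ⟩
    bundle f c d + bundle f d c
      ≤⟨ +-mono-≤ (bundle≤ c d) (bundle≤ d c) ⟩
    cross f + cross f
      ≡⟨ cong (cross f +_) (+-identityʳ _) ⟨
    2 * cross f ∎
    where
    open ≤-Reasoning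
    a : Config p n → ℕ
    a x = 𝟙 (avoid c d x)
    bundle≡ : {c d : Fin p} → c ≢ d → ∑ᶜ (λ x → 𝟙 (avoid c d x) * (slice c f x ∸ slice d f x)) ≡ bundle f c d
    bundle≡ c≢d rewrite ==ᶠ-≢ c≢d = sym (+-identityʳ _)
    bundle≤ : ∀ c d → bundle f c d ≤ cross f
    bundle≤ c d = ≤-trans (∑ᶠ-term (bundle f c) d) (∑ᶠ-term (λ c → ∑ᶠ (bundle f c)) c)

  triangle₃ : ∀ a b c d → ∣ a - d ∣ ≤ ∣ a - b ∣ + ∣ b - c ∣ + ∣ c - d ∣
  triangle₃ a b c d = ≤-trans (∣-∣-triangle a c d) (+-monoˡ-≤ ∣ c - d ∣ (∣-∣-triangle a b c))

  -- Moving the discs off peg j onto peg k: recursively clear the way for the largest disc, move it, and rearrange again.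
  -- The three stages use disjoint edges, so no constant is lost from one level to the next.
  W-exchange : {i j k : Fin p} → i ≢ j → i ≢ k → j ≢ k → (f : Config p n → ℕ) →
               ∣ W i k f - W i j f ∣ ≤ 2 * energy f
  W-exchange {p} {zero} i≢j i≢k j≢k f = ≤-trans (≤-reflexive (∣n-n∣≡0 (f [] + 0 + 0))) z≤n
  W-exchange {p} {suc n} {i} {j} {k} i≢j i≢k j≢k f = begin
    ∣ W i k f - W i j f ∣
      -- Configurations off {i,k} have the largest disc on j or on a peg outside {i,j,k}; those off
      -- {i,j} have it on k or outside. `r` marks the outside pegs, where induction applies slice by
      -- slice.
      ≡⟨ cong₂ ∣_-_∣ (decompose i k j rest-k) (decompose i j k rest-j) ⟩
    ∣ ∑ᶠ (λ c → r c * X c) + X j - ∑ᶠ (λ c → r c * Y c) + Y k ∣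
      ≤⟨ ∣+-+∣≤ (∑ᶠ (λ c → r c * X c)) (X j) _ (Y k) ⟩
    ∣ ∑ᶠ (λ c → r c * X c) - ∑ᶠ (λ c → r c * Y c) ∣ + ∣ X j - Y k ∣
      ≤⟨ +-mono-≤ staying moving ⟩
    ∑ᶠ (λ c → r c * (2 * e c)) + (2 * e j + 2 * cross f + 2 * e k)
      ≡⟨ rearrange (∑ᶠ (λ c → r c * (2 * e c))) (2 * e j) (2 * cross f) (2 * e k) ⟩
    ∑ᶠ (λ c → r c * (2 * e c)) + 2 * e j + 2 * e k + 2 * cross f
      ≡⟨ cong (_+ 2 * cross f) (cong₂ _+_ (cong (∑ᶠ (λ c → r c * (2 * e c)) +_) (sym (∑ᶠ-δ j (λ c → 2 * e c)))) (sym (∑ᶠ-δ k (λ c → 2 * e c)))) ⟩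
    ∑ᶠ (λ c → r c * (2 * e c)) + ∑ᶠ (λ c → 𝟙 (c ==ᶠ j) * (2 * e c)) + ∑ᶠ (λ c → 𝟙 (c ==ᶠ k) * (2 * e c)) + 2 * cross f
      ≡⟨ cong (_+ 2 * cross f) (trans (∑-+ (allFin p) _ _) (cong (_+ ∑ᶠ (λ c → 𝟙 (c ==ᶠ k) * (2 * e c))) (∑-+ (allFin p) _ _))) ⟨
    ∑ᶠ (λ c → r c * (2 * e c) + 𝟙 (c ==ᶠ j) * (2 * e c) + 𝟙 (c ==ᶠ k) * (2 * e c)) + 2 * cross f
      -- The outside pegs, j and k are disjoint, so each slice energy is used at most once. The
      -- slice energies and `cross f` add up to `energy f`, and the constant 2 reproduces itself.
      ≤⟨ +-monoˡ-≤ (2 * cross f) (∑-mono (allFin p) collect) ⟩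
    ∑ᶠ (λ c → 2 * e c) + 2 * cross f
      ≡⟨ cong (_+ 2 * cross f) (∑-*ˡ (allFin p) 2 e) ⟩
    2 * ∑ᶠ e + 2 * cross f
      ≡⟨ *-distribˡ-+ 2 (∑ᶠ e) (cross f) ⟨
    2 * (∑ᶠ e + cross f)
      ≡⟨ cong (2 *_) (energy-∷ʳ f) ⟨
    2 * energy f ∎
    where
    open ≤-Reasoning
    X Y e r : Fin p → ℕ
    X c = W i k (slice c f)
    Y c = W i j (slice c f)
    e c = energy (slice c f)
    r c = 𝟙 (other i j c) * 𝟙 (other i k c)
    rearrange : ∀ s a b c → s + (a + b + c) ≡ s + a + c + b
    rearrange = solve-∀
    rest-k : ∀ c → 𝟙 (other i k c) ≡ r c + 𝟙 (c ==ᶠ j)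
    rest-k c with c Fin.≟ i | c Fin.≟ j | c Fin.≟ k
    ... | yes refl | yes i≡j  | _        = contradiction i≡j i≢j
    ... | yes _    | no _     | _        = refl
    ... | no _     | yes refl | yes j≡k  = contradiction j≡k j≢k
    ... | no _     | yes _    | no _     = refl
    ... | no _     | no _     | yes _    = refl
    ... | no _     | no _     | no _     = refl
    rest-j : ∀ c → 𝟙 (other i j c) ≡ r c + 𝟙 (c ==ᶠ k)
    rest-j c with c Fin.≟ i | c Fin.≟ j | c Fin.≟ k
    ... | yes refl | _        | yes i≡k  = contradiction i≡k i≢k
    ... | yes _    | _        | no _     = refl
    ... | no _     | yes refl | yes j≡k  = contradiction j≡k j≢k
    ... | no _     | yes _    | no _     = refl
    ... | no _     | no _     | yes _    = refl
    ... | no _     | no _     | no _     = refl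
    collect : ∀ c → r c * (2 * e c) + 𝟙 (c ==ᶠ j) * (2 * e c) + 𝟙 (c ==ᶠ k) * (2 * e c) ≤ 2 * e c
    collect c with c Fin.≟ i | c Fin.≟ j | c Fin.≟ k
    ... | yes refl | yes i≡j  | _        = contradiction i≡j i≢j
    ... | yes refl | _        | yes i≡k  = contradiction i≡k i≢k
    ... | yes _    | no _     | no _     = z≤n
    ... | no _     | yes refl | yes j≡k  = contradiction j≡k j≢k
    ... | no _     | yes _    | no _     = ≤-reflexive (trans (+-identityʳ _) (+-identityʳ _))
    ... | no _     | no _     | yes _    = ≤-reflexive (+-identityʳ _)
    ... | no _     | no _     | no _     = ≤-reflexive (trans (+-identityʳ _) (trans (+-identityʳ _) (+-identityʳ _)))
    decompose : ∀ a b l → (∀ c → 𝟙 (other a b c) ≡ r c + 𝟙 (c ==ᶠ l)) →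
                W a b f ≡ ∑ᶠ (λ c → r c * W a b (slice c f)) + W a b (slice l f)
    decompose a b l rest = begin-equality
      W a b f
        ≡⟨ W-∷ʳ a b f ⟩
      ∑ᶠ (λ c → 𝟙 (other a b c) * Z c)
        ≡⟨ ∑-cong (allFin p) (λ c → trans (cong (_* Z c) (rest c)) (*-distribʳ-+ (Z c) (r c) _)) ⟩
      ∑ᶠ (λ c → r c * Z c + 𝟙 (c ==ᶠ l) * Z c)
        ≡⟨ ∑-+ (allFin p) _ _ ⟩
      ∑ᶠ (λ c → r c * Z c) + ∑ᶠ (λ c → 𝟙 (c ==ᶠ l) * Z c)
        ≡⟨ cong (∑ᶠ (λ c → r c * Z c) +_) (∑ᶠ-δ l Z) ⟩
      ∑ᶠ (λ c → r c * Z c) + Z l ∎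
      where
      Z : Fin p → ℕ
      Z c = W a b (slice c f)
    staying : ∣ ∑ᶠ (λ c → r c * X c) - ∑ᶠ (λ c → r c * Y c) ∣ ≤ ∑ᶠ (λ c → r c * (2 * e c))
    staying = ≤-trans (∑-∣-∣ (allFin p) _ _) (∑-mono (allFin p) (λ c →
      ≤-trans (≤-reflexive (sym (*-distribˡ-∣-∣ (r c) (X c) (Y c))))
              (*-monoʳ-≤ (r c) (W-exchange i≢j i≢k j≢k (slice c f)))))
    -- With the largest disc on j, exchange {i,k} for {j,k}, which clears both pegs of its move;
    -- move it to k; there exchange {j,k} for {i,j}.
    moving : ∣ X j - Y k ∣ ≤ 2 * e j + 2 * cross f + 2 * e k
    moving = ≤-trans (triangle₃ (X j) (W j k (slice j f)) (W j k (slice k f)) (Y k))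
      (+-mono-≤ (+-mono-≤
        (subst (_≤ 2 * e j) (cong₂ ∣_-_∣ (W-comm k i (slice j f)) (W-comm k j (slice j f)))
          (W-exchange (j≢k ∘ sym) (i≢k ∘ sym) (i≢j ∘ sym) (slice j f)))
        (W-transfer j≢k f))
        (subst (_≤ 2 * e k) (cong (∣ W j k (slice k f) -_∣) (W-comm j i (slice k f)))
          (W-exchange (i≢j ∘ sym) j≢k i≢k (slice k f))))

  W-share : {i j k : Fin p} → i ≢ j → i ≢ k → (f : Config p n → ℕ) →
            ∣ W i j f - W i k f ∣ ≤ 2 * energy f
  W-share {i = i} {j} {k} i≢j i≢k f with j Fin.≟ k
  ... | yes refl = ≤-trans (≤-reflexive (∣n-n∣≡0 (W i j f))) z≤n
  ... | no j≢k   = W-exchange i≢k i≢j (j≢k ∘ sym) f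

  -- If i and k differ, the pair {i,k} shares a peg with each of the two given pairs, which makes
  -- two exchanges of cost 2; if i = k, one exchange is enough.
  W-any : {i j k l : Fin p} → i ≢ j → k ≢ l → (f : Config p n → ℕ) →
          ∣ W i j f - W k l f ∣ ≤ 4 * energy f
  W-any {i = i} {j} {k} {l} i≢j k≢l f with i Fin.≟ k
  ... | yes refl = ≤-trans (W-share i≢j k≢l f) (*-monoˡ-≤ (energy f) {2} {4} (s≤s (s≤s z≤n)))
  ... | no i≢k = begin
    ∣ W i j f - W k l f ∣                         ≤⟨ ∣-∣-triangle (W i j f) (W i k f) (W k l f) ⟩
    ∣ W i j f - W i k f ∣ + ∣ W i k f - W k l f ∣ ≡⟨ cong (λ w → ∣ W i j f - W i k f ∣ + ∣ w - W k l f ∣) (W-comm i k f) ⟩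
    ∣ W i j f - W i k f ∣ + ∣ W k i f - W k l f ∣ ≤⟨ +-mono-≤ (W-share i≢j i≢k f) (W-share (i≢k ∘ sym) k≢l f) ⟩
    2 * energy f + 2 * energy f                   ≡⟨ *-distribʳ-+ (energy f) 2 2 ⟨
    4 * energy f                                  ∎
    where open ≤-Reasoning

  -- Comparison of means

  -- The pair {i,j} need not be the one that the largest disc crosses between c and d. Changing to
  -- {c,d}, moving the disc and changing back costs 4 + 2 + 4.
  W-slices : {i j : Fin p} → i ≢ j → (f : Config p (suc n) → ℕ) (c d : Fin p) →
             ∣ W i j (slice c f) - W i j (slice d f) ∣ ≤ 10 * energy f
  W-slices {i = i} {j} i≢j f c d with c Fin.≟ d
  ... | yes refl = ≤-trans (≤-reflexive (∣n-n∣≡0 (W i j (slice c f)))) z≤n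
  ... | no c≢d = begin
    ∣ W i j (slice c f) - W i j (slice d f) ∣
      ≤⟨ triangle₃ (W i j (slice c f)) (W c d (slice c f)) (W c d (slice d f)) (W i j (slice d f)) ⟩
    ∣ W i j (slice c f) - W c d (slice c f) ∣ + ∣ W c d (slice c f) - W c d (slice d f) ∣ + ∣ W c d (slice d f) - W i j (slice d f) ∣
      ≤⟨ +-mono-≤ (+-mono-≤ (W-any i≢j c≢d (slice c f)) (W-transfer c≢d f)) (W-any c≢d i≢j (slice d f)) ⟩
    4 * energy (slice c f) + 2 * cross f + 4 * energy (slice d f)
      ≤⟨ +-mono-≤ (+-mono-≤ (*-monoʳ-≤ 4 (energy-slice≤ f c)) (*-monoʳ-≤ 2 (cross≤energy f))) (*-monoʳ-≤ 4 (energy-slice≤ f d)) ⟩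
    4 * energy f + 2 * energy f + 4 * energy f
      ≡⟨ collect (energy f) ⟩
    10 * energy f ∎
    where
    open ≤-Reasoning
    collect : ∀ e → 4 * e + 2 * e + 4 * e ≡ 10 * e
    collect = solve-∀

  ∑-other : {i j : Fin p} → i ≢ j → ∑ᶠ (λ c → 𝟙 (other i j c)) + 2 ≡ p
  ∑-other {p} {i} {j} i≢j = begin
    ∑ᶠ (λ c → 𝟙 (other i j c)) + 2
      ≡⟨ cong (∑ᶠ (λ c → 𝟙 (other i j c)) +_) (cong₂ _+_ (∑ᶠ-δ i (λ _ → 1)) (∑ᶠ-δ j (λ _ → 1))) ⟨
    ∑ᶠ (λ c → 𝟙 (other i j c)) + (∑ᶠ (λ c → 𝟙 (c ==ᶠ i) * 1) + ∑ᶠ (λ c → 𝟙 (c ==ᶠ j) * 1))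
      ≡⟨ cong (∑ᶠ (λ c → 𝟙 (other i j c)) +_) (∑-+ (allFin p) _ _) ⟨
    ∑ᶠ (λ c → 𝟙 (other i j c)) + ∑ᶠ (λ c → 𝟙 (c ==ᶠ i) * 1 + 𝟙 (c ==ᶠ j) * 1)
      ≡⟨ ∑-+ (allFin p) _ _ ⟨
    ∑ᶠ (λ c → 𝟙 (other i j c) + (𝟙 (c ==ᶠ i) * 1 + 𝟙 (c ==ᶠ j) * 1))
      ≡⟨ ∑-cong (allFin p) exactlyOne ⟩
    ∑ᶠ {p} (λ _ → 1)
      ≡⟨ ∑ᶠ-const p 1 ⟩
    p * 1
      ≡⟨ *-identityʳ p ⟩
    p ∎
    where
    open ≡-Reasoning
    exactlyOne : ∀ c → 𝟙 (other i j c) + (𝟙 (c ==ᶠ i) * 1 + 𝟙 (c ==ᶠ j) * 1) ≡ 1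
    exactlyOne c with c Fin.≟ i | c Fin.≟ j
    ... | yes refl | yes i≡j = contradiction i≡j i≢j
    ... | yes _    | no _    = refl
    ... | no _     | yes _   = refl
    ... | no _     | no _    = refl

  ∣∑-p*∣≤ : (g : Fin p → ℕ) (b : ℕ) → (∀ c d → ∣ g c - g d ∣ ≤ b) → ∀ d → ∣ ∑ᶠ g - p * g d ∣ ≤ p * b
  ∣∑-p*∣≤ {p} g b close d = begin
    ∣ ∑ᶠ g - p * g d ∣                ≡⟨ cong (∣ ∑ᶠ g -_∣) (∑ᶠ-const p (g d)) ⟨
    ∣ ∑ᶠ g - ∑ᶠ {p} (λ _ → g d) ∣     ≤⟨ ∑-∣-∣ (allFin p) g (λ _ → g d) ⟩
    ∑ᶠ (λ c → ∣ g c - g d ∣)          ≤⟨ ∑-mono (allFin p) (λ c → close c d) ⟩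
    ∑ᶠ {p} (λ _ → b)                  ≡⟨ ∑ᶠ-const p b ⟩
    p * b                             ∎
    where open ≤-Reasoning

  module Means (p q : ℕ) (p≡2+q : p ≡ 2 + q) where

    ∑-other≡q : {i j : Fin p} → i ≢ j → ∑ᶠ (λ c → 𝟙 (other i j c)) ≡ q
    ∑-other≡q i≢j = +-cancelʳ-≡ 2 _ _ (trans (∑-other i≢j) (trans p≡2+q (+-comm 2 q)))

    -- Compares the mean of g over all p pegs with its mean over the q pegs other than i and j,
    -- multiplied through by p q: each selected value is within b of the overall mean.
    ∣∑∣-weighted : {i j : Fin p} → i ≢ j → (g : Fin p → ℕ) (b : ℕ) → (∀ c d → ∣ g c - g d ∣ ≤ b) →
               ∣ q * ∑ᶠ g - p * ∑ᶠ (λ c → 𝟙 (other i j c) * g c) ∣ ≤ q * (p * b)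
    ∣∑∣-weighted {i} {j} i≢j g b close = begin
      ∣ q * ∑ᶠ g - p * ∑ᶠ (λ c → o c * g c) ∣
        ≡⟨ cong₂ ∣_-_∣ (trans (cong (_* ∑ᶠ g) (sym (∑-other≡q i≢j))) (sym (∑-*ʳ (allFin p) (∑ᶠ g) o)))
                       (trans (sym (∑-*ˡ (allFin p) p (λ c → o c * g c))) (∑-cong (allFin p) (λ c → *-exchange p (o c) (g c)))) ⟩
      ∣ ∑ᶠ (λ c → o c * ∑ᶠ g) - ∑ᶠ (λ c → o c * (p * g c)) ∣
        ≤⟨ ∑-∣-∣ (allFin p) _ _ ⟩
      ∑ᶠ (λ c → ∣ o c * ∑ᶠ g - o c * (p * g c) ∣)
        ≡⟨ ∑-cong (allFin p) (λ c → sym (*-distribˡ-∣-∣ (o c) (∑ᶠ g) (p * g c))) ⟩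
      ∑ᶠ (λ c → o c * ∣ ∑ᶠ g - p * g c ∣)
        ≤⟨ ∑-mono (allFin p) (λ c → *-monoʳ-≤ (o c) (∣∑-p*∣≤ g b close c)) ⟩
      ∑ᶠ (λ c → o c * (p * b))
        ≡⟨ ∑-*ʳ (allFin p) (p * b) o ⟩
      ∑ᶠ o * (p * b)
        ≡⟨ cong (_* (p * b)) (∑-other≡q i≢j) ⟩
      q * (p * b) ∎
      where
      open ≤-Reasoning
      o : Fin p → ℕ
      o c = 𝟙 (other i j c)

    -- The solution of the recursion p κ = q κ + 10 q p of mean-avoid.
    κ : ℕ
    κ = 5 * (q * p)

    -- A comparison of two means, multiplied through by qⁿ pⁿ to avoid division.
    mean-avoid : {i j : Fin p} → i ≢ j → (f : Config p n → ℕ) →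
                 ∣ q ^ n * ∑ᶜ f - p ^ n * W i j f ∣ ≤ κ * p ^ n * energy f
    mean-avoid {zero} {i} {j} i≢j f = ≤-trans
      (≤-reflexive (trans (cong (λ w → ∣ 1 * (f [] + 0) - 1 * (w + 0) ∣) (*-identityˡ (f []))) (∣n-n∣≡0 (1 * (f [] + 0))))) z≤n
    mean-avoid {suc n} {i} {j} i≢j f = begin
      ∣ q ^ suc n * ∑ᶜ f - p ^ suc n * W i j f ∣
        ≡⟨ cong₂ (λ s w → ∣ q ^ suc n * s - p ^ suc n * w ∣) (∑ᶜ-∷ʳ f) (W-∷ʳ i j f) ⟩
      ∣ q ^ suc n * ∑ᶠ t - p ^ suc n * Y ∣
        -- The intermediate quantity replaces each slice sum by its two-peg-avoiding sum but still
        -- runs over all p pegs. `within` is the induction on slices; `between` restricts to the q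
        -- allowed pegs.
        ≤⟨ ∣-∣-triangle (q ^ suc n * ∑ᶠ t) (q * (N * ∑ᶠ X)) (p ^ suc n * Y) ⟩
      ∣ q ^ suc n * ∑ᶠ t - q * (N * ∑ᶠ X) ∣ + ∣ q * (N * ∑ᶠ X) - p ^ suc n * Y ∣
        ≤⟨ +-mono-≤ within between ⟩
      q * (κ * N * energy f) + N * (q * (p * (10 * energy f)))
        ≡⟨ combine p≡2+q N (energy f) ⟩
      κ * p ^ suc n * energy f ∎
      where
      open ≤-Reasoning
      N = p ^ n
      t X : Fin p → ℕ
      t c = ∑ᶜ (slice c f)
      X c = W i j (slice c f)
      Y = ∑ᶠ (λ c → 𝟙 (other i j c) * X c)
      identity : ∀ q N e → q * (5 * (q * (2 + q)) * N * e) + N * (q * ((2 + q) * (10 * e))) ≡ 5 * (q * (2 + q)) * ((2 + q) * N) * e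
      identity = solve-∀
      combine : ∀ {p} → p ≡ 2 + q → ∀ N e → q * (5 * (q * p) * N * e) + N * (q * (p * (10 * e))) ≡ 5 * (q * p) * (p * N) * e
      combine refl = identity q
      between : ∣ q * (N * ∑ᶠ X) - p ^ suc n * Y ∣ ≤ N * (q * (p * (10 * energy f)))
      between = begin
        ∣ q * (N * ∑ᶠ X) - p ^ suc n * Y ∣
          ≡⟨ cong₂ ∣_-_∣ (*-exchange q N (∑ᶠ X)) (trans (*-assoc p N Y) (*-exchange p N Y)) ⟩
        ∣ N * (q * ∑ᶠ X) - N * (p * Y) ∣
          ≡⟨ *-distribˡ-∣-∣ N (q * ∑ᶠ X) (p * Y) ⟨
        N * ∣ q * ∑ᶠ X - p * Y ∣
          ≤⟨ *-monoʳ-≤ N (∣∑∣-weighted i≢j X (10 * energy f) (W-slices i≢j f)) ⟩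
        N * (q * (p * (10 * energy f))) ∎
      within : ∣ q ^ suc n * ∑ᶠ t - q * (N * ∑ᶠ X) ∣ ≤ q * (κ * N * energy f)
      within = begin
        ∣ q ^ suc n * ∑ᶠ t - q * (N * ∑ᶠ X) ∣
          ≡⟨ cong (λ s → ∣ s - q * (N * ∑ᶠ X) ∣) (*-assoc q (q ^ n) (∑ᶠ t)) ⟩
        ∣ q * (q ^ n * ∑ᶠ t) - q * (N * ∑ᶠ X) ∣
          ≡⟨ *-distribˡ-∣-∣ q _ _ ⟨
        q * ∣ q ^ n * ∑ᶠ t - N * ∑ᶠ X ∣
          ≡⟨ cong (q *_) (cong₂ ∣_-_∣ (∑-*ˡ (allFin p) (q ^ n) t) (∑-*ˡ (allFin p) N X)) ⟨
        q * ∣ ∑ᶠ (λ c → q ^ n * t c) - ∑ᶠ (λ c → N * X c) ∣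
          ≤⟨ *-monoʳ-≤ q (≤-trans (∑-∣-∣ (allFin p) _ _) (∑-mono (allFin p) (λ c → mean-avoid i≢j (slice c f)))) ⟩
        q * ∑ᶠ (λ c → κ * N * energy (slice c f))
          ≡⟨ cong (q *_) (∑-*ˡ (allFin p) (κ * N) (λ c → energy (slice c f))) ⟩
        q * (κ * N * ∑ᶠ (λ c → energy (slice c f)))
          -- Because slice energies add up to at most `energy f`, the p inductive bounds do not
          -- multiply κ by p: the old error re-enters with the factor q / p < 1 and stays bounded.
          ≤⟨ *-monoʳ-≤ q (*-monoʳ-≤ (κ * N) (∑-energy-slice≤ f)) ⟩
        q * (κ * N * energy f) ∎

    -- Each slice mean is compared with the sum avoiding the pair {c,d} itself, for which
    -- `W-transfer` relates the two slices; 2 (κ + 1) is κ + 2 + κ.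
    mean-slices : (f : Config p (suc n) → ℕ) (c d : Fin p) →
                  ∣ q ^ n * ∑ᶜ (slice c f) - q ^ n * ∑ᶜ (slice d f) ∣ ≤ 2 * (κ + 1) * p ^ n * energy f
    mean-slices {n} f c d with c Fin.≟ d
    ... | yes refl = ≤-trans (≤-reflexive (∣n-n∣≡0 (q ^ n * ∑ᶜ (slice c f)))) z≤n
    ... | no c≢d = begin
      ∣ q ^ n * ∑ᶜ (slice c f) - q ^ n * ∑ᶜ (slice d f) ∣
        ≤⟨ triangle₃ (q ^ n * ∑ᶜ (slice c f)) (N * W c d (slice c f)) (N * W c d (slice d f)) (q ^ n * ∑ᶜ (slice d f)) ⟩
      ∣ q ^ n * ∑ᶜ (slice c f) - N * W c d (slice c f) ∣ + ∣ N * W c d (slice c f) - N * W c d (slice d f) ∣ + ∣ N * W c d (slice d f) - q ^ n * ∑ᶜ (slice d f) ∣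
        ≡⟨ cong₂ _+_ (cong (∣ q ^ n * ∑ᶜ (slice c f) - N * W c d (slice c f) ∣ +_) (sym (*-distribˡ-∣-∣ N _ _))) (∣-∣-comm (N * W c d (slice d f)) _) ⟩
      ∣ q ^ n * ∑ᶜ (slice c f) - N * W c d (slice c f) ∣ + N * ∣ W c d (slice c f) - W c d (slice d f) ∣ + ∣ q ^ n * ∑ᶜ (slice d f) - N * W c d (slice d f) ∣
        ≤⟨ +-mono-≤ (+-mono-≤ (mean-avoid c≢d (slice c f)) (*-monoʳ-≤ N (W-transfer c≢d f))) (mean-avoid c≢d (slice d f)) ⟩
      κ * N * energy (slice c f) + N * (2 * cross f) + κ * N * energy (slice d f)
        ≤⟨ +-mono-≤ (+-mono-≤ (*-monoʳ-≤ (κ * N) (energy-slice≤ f c)) (*-monoʳ-≤ N (*-monoʳ-≤ 2 (cross≤energy f)))) (*-monoʳ-≤ (κ * N) (energy-slice≤ f d)) ⟩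
      κ * N * energy f + N * (2 * energy f) + κ * N * energy f
        ≡⟨ combine κ N (energy f) ⟩
      2 * (κ + 1) * N * energy f ∎
      where
      open ≤-Reasoning
      N = p ^ n
      combine : ∀ k N e → k * N * e + N * (2 * e) + k * N * e ≡ 2 * (k + 1) * N * e
      combine = solve-∀

    -- The L¹ Poincaré inequality

    -- pⁿ times the L¹ distance of f to its mean
    deviation : (Config p n → ℕ) → ℕ
    deviation {n} f = ∑ᶜ (λ x → ∣ p ^ n * f x - ∑ᶜ f ∣)

    -- The solution K of p K = q K + 2 q p (κ + 1), the recursion produced by the induction in
    -- `poincaré`, found from p - q = 2.
    poincaré-constant : ℕ
    poincaré-constant = q * p * (κ + 1)

    -- The distance of a value to the overall mean is at most its distance to the mean of its slice
    -- plus the gap between the two means. The first part is inductive, with energies adding up over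
    -- the slices; the second comes from `mean-slices`.
    poincaré : (f : Config p n → ℕ) → q ^ n * deviation f ≤ poincaré-constant * (p ^ n * p ^ n) * energy f
    poincaré {zero} f = ≤-trans (≤-reflexive base-case) z≤n
      where
      base-case : 1 * (∣ 1 * f [] - f [] + 0 ∣ + 0) ≡ 0
      base-case = cong (λ s → 1 * (s + 0)) (∣n-n∣≡0 (f [] + 0))
    poincaré {suc n} f = begin
      q ^ suc n * deviation f
        ≡⟨ trans (*-assoc q (q ^ n) _) (cong (λ s → q * (q ^ n * s)) (∑ᶜ-∷ʳ (λ x → ∣ p ^ suc n * f x - ∑ᶜ f ∣))) ⟩
      q * (q ^ n * ∑ᶠ (λ c → ∑ᶜ (λ x → ∣ p ^ suc n * slice c f x - ∑ᶜ f ∣)))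
        ≡⟨ cong (q *_) (∑-*ˡ (allFin p) (q ^ n) _) ⟨
      q * ∑ᶠ (λ c → q ^ n * ∑ᶜ (λ x → ∣ p ^ suc n * slice c f x - ∑ᶜ f ∣))
        ≤⟨ *-monoʳ-≤ q (∑-mono (allFin p) perPeg) ⟩
      q * ∑ᶠ (λ c → p * (K * (N * N) * e c) + N * (p * D))
        ≡⟨ cong (q *_) (trans (∑-+ (allFin p) _ _) (cong₂ _+_
             (trans (∑-*ˡ (allFin p) p _) (cong (p *_) (∑-*ˡ (allFin p) (K * (N * N)) e)))
             (∑ᶠ-const p (N * (p * D))))) ⟩
      q * (p * (K * (N * N) * ∑ᶠ e) + p * (N * (p * D)))
        ≤⟨ *-monoʳ-≤ q (+-monoˡ-≤ (p * (N * (p * D))) (*-monoʳ-≤ p (*-monoʳ-≤ (K * (N * N)) (∑-energy-slice≤ f)))) ⟩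
      q * (p * (K * (N * N) * energy f) + p * (N * (p * D)))
        ≡⟨ combine p≡2+q (κ + 1) N (energy f) ⟩
      K * (p ^ suc n * p ^ suc n) * energy f ∎
      where
      open ≤-Reasoning
      N = p ^ n
      K = poincaré-constant
      D = 2 * (κ + 1) * N * energy f
      e t : Fin p → ℕ
      e c = energy (slice c f)
      t c = ∑ᶜ (slice c f)
      identity : ∀ q k N e → q * ((2 + q) * (q * (2 + q) * k * (N * N) * e) + (2 + q) * (N * ((2 + q) * (2 * k * N * e))))
                ≡ q * (2 + q) * k * ((2 + q) * N * ((2 + q) * N)) * e
      identity = solve-∀
      combine : ∀ {p} → p ≡ 2 + q → ∀ k N e → q * (p * (q * p * k * (N * N) * e) + p * (N * (p * (2 * k * N * e))))
                ≡ q * p * k * (p * N * (p * N)) * e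
      combine refl = identity q
      perVertex : ∀ c x → ∣ p ^ suc n * slice c f x - ∑ᶜ f ∣ ≤ p * ∣ N * slice c f x - t c ∣ + ∣ p * t c - ∑ᶠ t ∣
      perVertex c x = begin
        ∣ p ^ suc n * slice c f x - ∑ᶜ f ∣
          ≡⟨ cong₂ ∣_-_∣ (*-assoc p N (slice c f x)) (∑ᶜ-∷ʳ f) ⟩
        ∣ p * (N * slice c f x) - ∑ᶠ t ∣
          ≤⟨ ∣-∣-triangle (p * (N * slice c f x)) (p * t c) (∑ᶠ t) ⟩
        ∣ p * (N * slice c f x) - p * t c ∣ + ∣ p * t c - ∑ᶠ t ∣
          ≡⟨ cong (_+ ∣ p * t c - ∑ᶠ t ∣) (sym (*-distribˡ-∣-∣ p (N * slice c f x) (t c))) ⟩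
        p * ∣ N * slice c f x - t c ∣ + ∣ p * t c - ∑ᶠ t ∣ ∎
      -- The overall mean is the average of the slice means, so it inherits their pairwise
      -- closeness.
      meanGap : ∀ c → q ^ n * ∣ p * t c - ∑ᶠ t ∣ ≤ p * D
      meanGap c = begin
        q ^ n * ∣ p * t c - ∑ᶠ t ∣
          ≡⟨ cong (q ^ n *_) (∣-∣-comm (p * t c) (∑ᶠ t)) ⟩
        q ^ n * ∣ ∑ᶠ t - p * t c ∣
          ≡⟨ *-distribˡ-∣-∣ (q ^ n) (∑ᶠ t) (p * t c) ⟩
        ∣ q ^ n * ∑ᶠ t - q ^ n * (p * t c) ∣
          ≡⟨ cong₂ ∣_-_∣ (sym (∑-*ˡ (allFin p) (q ^ n) t)) (*-exchange (q ^ n) p (t c)) ⟩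
        ∣ ∑ᶠ (λ d → q ^ n * t d) - p * (q ^ n * t c) ∣
          ≤⟨ ∣∑-p*∣≤ (λ d → q ^ n * t d) D (mean-slices f) c ⟩
        p * D ∎
      perPeg : ∀ c → q ^ n * ∑ᶜ (λ x → ∣ p ^ suc n * slice c f x - ∑ᶜ f ∣) ≤ p * (K * (N * N) * e c) + N * (p * D)
      perPeg c = begin
        q ^ n * ∑ᶜ (λ x → ∣ p ^ suc n * slice c f x - ∑ᶜ f ∣)
          ≤⟨ *-monoʳ-≤ (q ^ n) (∑-mono (allConfigs p n) (perVertex c)) ⟩
        q ^ n * ∑ᶜ (λ x → p * ∣ N * slice c f x - t c ∣ + ∣ p * t c - ∑ᶠ t ∣)
          ≡⟨ cong (q ^ n *_) (trans (∑-+ (allConfigs p n) _ _) (cong₂ _+_ (∑-*ˡ (allConfigs p n) p _) (∑ᶜ-const n _))) ⟩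
        q ^ n * (p * deviation (slice c f) + N * ∣ p * t c - ∑ᶠ t ∣)
          ≡⟨ trans (*-distribˡ-+ (q ^ n) _ _) (cong₂ _+_ (*-exchange (q ^ n) p _) (*-exchange (q ^ n) N _)) ⟩
        p * (q ^ n * deviation (slice c f)) + N * (q ^ n * ∣ p * t c - ∑ᶠ t ∣)
          ≤⟨ +-mono-≤ (*-monoʳ-≤ p (poincaré (slice c f))) (*-monoʳ-≤ N (meanGap c)) ⟩
        p * (K * (N * N) * e c) + N * (p * D) ∎

  -- Vertex sets

  -- Gives the form to which the library facts on uniqueness and membership in products apply.
  allConfigs-product : ∀ p n → allConfigs p (suc n) ≡ cartesianProductWith (λ v c → c ∷ v) (allConfigs p n) (allFin p)
  allConfigs-product p n = go (allConfigs p n)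
    where
    go : ∀ vs → concatMap (λ v → map (_∷ v) (allFin p)) vs ≡ cartesianProductWith (λ v c → c ∷ v) vs (allFin p)
    go []       = refl
    go (v ∷ vs) = cong (map (_∷ v) (allFin p) ++_) (go vs)

  allConfigs-unique : ∀ p n → Unique (allConfigs p n)
  allConfigs-unique p zero    = [] ∷ []
  allConfigs-unique p (suc n) = subst Unique (sym (allConfigs-product p n))
    (Unique.cartesianProductWith⁺ (λ v c → c ∷ v) (λ { refl → refl , refl }) (allConfigs-unique p n) (Unique.allFin⁺ p))

  ∈-allConfigs : (v : Config p n) → v ∈ allConfigs p n
  ∈-allConfigs []      = here refl
  ∈-allConfigs {p} {suc n} (c ∷ v) = subst ((c ∷ v) ∈_) (sym (allConfigs-product p n))
    (∈-cartesianProductWith⁺ (λ v c → c ∷ v) (∈-allConfigs v) (∈-allFin c))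

  sublists-⊆ : (xs : List A) {S : List A} {x : A} → S ∈ sublists xs → x ∈ S → x ∈ xs
  sublists-⊆ [] (here refl) ()
  sublists-⊆ (y ∷ xs) S∈ x∈S with ∈-++⁻ (sublists xs) S∈
  ... | inj₁ S∈ = there (sublists-⊆ xs S∈ x∈S)
  ... | inj₂ S∈ with ∈-map⁻ (y ∷_) S∈
  sublists-⊆ (y ∷ xs) _ (here x≡y)   | inj₂ _ | S , S∈ , refl = here x≡y
  sublists-⊆ (y ∷ xs) _ (there x∈S)  | inj₂ _ | S , S∈ , refl = there (sublists-⊆ xs S∈ x∈S)

  filterᵇ-∈-sublists : (P : A → Bool) (xs : List A) → filterᵇ P xs ∈ sublists xs
  filterᵇ-∈-sublists P [] = here refl
  filterᵇ-∈-sublists P (x ∷ xs) with P x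
  ... | true  = ∈-++⁺ʳ (sublists xs) (∈-map⁺ (x ∷_) (filterᵇ-∈-sublists P xs))
  ... | false = ∈-++⁺ˡ (filterᵇ-∈-sublists P xs)

  memᶜ⇒∈ : (v : Config p n) (S : List (Config p n)) → T (memᶜ v S) → v ∈ S
  memᶜ⇒∈ v S t = Any.map toWitness (Any.any⁻ (v ==ᶜ_) S t)

  ∈⇒memᶜ : (v : Config p n) (S : List (Config p n)) → v ∈ S → T (memᶜ v S)
  ∈⇒memᶜ v S v∈S = Any.any⁺ (v ==ᶜ_) (Any.map fromWitness v∈S)

  memᶜ-filterᵇ : (P : Config p n → Bool) (v : Config p n) → memᶜ v (filterᵇ P (allConfigs p n)) ≡ P v
  memᶜ-filterᵇ {p} {n} P v = T-⇔⇒≡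
    (λ t → proj₂ (∈-filter⁻ (T? ∘ P) {xs = allConfigs p n} (memᶜ⇒∈ v _ t)))
    (λ t → ∈⇒memᶜ v _ (∈-filter⁺ (T? ∘ P) (∈-allConfigs v) t))

  ∑-cong-∈ : (xs : List A) {g h : A → ℕ} → (∀ {x} → x ∈ xs → g x ≡ h x) → ∑ xs g ≡ ∑ xs h
  ∑-cong-∈ xs e = cong sum (map-cong-local (All.tabulate e))

  -- As xs has no repetitions, the membership test recovers which positions S keeps: a skipped
  -- vertex cannot occur later in S, and a kept one is not counted again.
  ∑-sublist : (xs : List (Config p n)) {S : List (Config p n)} → Unique xs → S ∈ sublists xs → (g : Config p n → ℕ) →
              ∑ S g ≡ ∑ xs (λ u → 𝟙 (memᶜ u S) * g u)
  ∑-sublist [] _ (here refl) g = refl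
  ∑-sublist (x ∷ xs) {S} (x∉ ∷ uniq) S∈ g with ∈-++⁻ (sublists xs) S∈
  ... | inj₁ S∈ = trans (∑-sublist xs uniq S∈ g)
    (cong (λ b → 𝟙 b * g x + ∑ xs (λ u → 𝟙 (memᶜ u S) * g u)) (sym absent))
    where
    absent : memᶜ x S ≡ false
    absent = T-⇔⇒≡ (λ t → All.lookup x∉ (sublists-⊆ xs S∈ (memᶜ⇒∈ x S t)) refl) ⊥-elim
  ... | inj₂ S∈ with ∈-map⁻ (x ∷_) S∈
  ... | S′ , S′∈ , refl = cong₂ _+_
    (trans (sym (*-identityˡ (g x))) (cong (λ b → 𝟙 b * g x) (sym (Equivalence.to T-≡ (∈⇒memᶜ x (x ∷ S′) (here refl))))))
    (trans (∑-sublist xs uniq S′∈ g) (∑-cong-∈ xs (λ u∈ → cong (λ b → 𝟙 (b ∨ memᶜ _ S′) * g _) (sym (distinct u∈)))))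
    where
    distinct : ∀ {u} → u ∈ xs → (u ==ᶜ x) ≡ false
    distinct u∈ = T-⇔⇒≡ (λ t → All.lookup x∉ u∈ (sym (toWitness t))) ⊥-elim

  indicator : List (Config p n) → Config p n → ℕ
  indicator S u = 𝟙 (memᶜ u S)

  module _ {p n : ℕ} {S : List (Config p n)} (S∈ : S ∈ sublists (allConfigs p n)) where

    ∑-subset : (g : Config p n → ℕ) → ∑ S g ≡ ∑ᶜ (λ u → indicator S u * g u)
    ∑-subset = ∑-sublist (allConfigs p n) (allConfigs-unique p n) S∈

    length≡∑-indicator : length S ≡ ∑ᶜ (indicator S)
    length≡∑-indicator = begin
      length S                       ≡⟨ *-identityʳ _ ⟨
      length S * 1                   ≡⟨ ∑-const S 1 ⟨
      ∑ S (λ _ → 1)                  ≡⟨ ∑-subset (λ _ → 1) ⟩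
      ∑ᶜ (λ u → indicator S u * 1)   ≡⟨ ∑-cong (allConfigs p n) (λ u → *-identityʳ _) ⟩
      ∑ᶜ (indicator S)               ∎
      where open ≡-Reasoning

    -- For indicators, `𝟙 a ∸ 𝟙 b` is 1 exactly when a holds and b fails, so the truncated
    -- difference selects the edges that leave S.
    boundarySize≡energy : boundarySize p n S ≡ energy (indicator S)
    boundarySize≡energy = begin
      boundarySize p n S
        ≡⟨ ∑-cong S (λ u → ∑-filterᵇ (leaves u) (allConfigs p n)) ⟩
      ∑ S (λ u → ∑ᶜ (𝟙 ∘ leaves u))
        ≡⟨ ∑-subset (λ u → ∑ᶜ (𝟙 ∘ leaves u)) ⟩
      ∑ᶜ (λ u → indicator S u * ∑ᶜ (𝟙 ∘ leaves u))
        ≡⟨ ∑-cong (allConfigs p n) (λ u → trans (sym (∑-*ˡ (allConfigs p n) (indicator S u) (𝟙 ∘ leaves u)))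
             (∑-cong (allConfigs p n) (λ v → edge (memᶜ u S) (memᶜ v S) (adj u v)))) ⟩
      energy (indicator S) ∎
      where
      open ≡-Reasoning
      leaves : Config p n → Config p n → Bool
      leaves u v = not (memᶜ v S) ∧ adj u v
      edge : ∀ a b c → 𝟙 a * 𝟙 (not b ∧ c) ≡ 𝟙 c * (𝟙 a ∸ 𝟙 b)
      edge false false false = refl
      edge false false true  = refl
      edge false true  false = refl
      edge false true  true  = refl
      edge true  false false = refl
      edge true  false true  = refl
      edge true  true  false = refl
      edge true  true  true  = refl

  -- The isoperimetric inequality

  module Isoperimetry (p q : ℕ) (p≡2+q : p ≡ 2 + q) where
    open Means p q p≡2+q

    -- The mean of the indicator of S is at most 1/2, so at each point of S the indicator is at
    -- least 1/2 away from it. Hence |S| is at most twice the L¹ distance to the mean, which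
    -- `poincaré` bounds.
    isoperimetric : {S : List (Config p n)} → S ∈ sublists (allConfigs p n) → 2 * length S ≤ p ^ n →
                    q ^ n * length S ≤ 2 * poincaré-constant * p ^ n * boundarySize p n S
    -- One of the two factors pⁿ in `poincaré` belongs to the scaling of `deviation` and is
    -- cancelled here.
    isoperimetric {n} {S} S∈ small = *-cancelˡ-≤ N {{N≢0}} (begin
      N * (q ^ n * length S)
        ≡⟨ *-exchange N (q ^ n) (length S) ⟩
      q ^ n * (N * length S)
        ≡⟨ cong (λ s → q ^ n * (N * s)) (length≡∑-indicator S∈) ⟩
      q ^ n * (N * ∑ᶜ f)
        ≡⟨ cong (q ^ n *_) (∑-*ˡ (allConfigs p n) N f) ⟨
      q ^ n * ∑ᶜ (λ x → N * f x)
        ≤⟨ *-monoʳ-≤ (q ^ n) (∑-mono (allConfigs p n) (λ x → far (memᶜ x S))) ⟩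
      q ^ n * ∑ᶜ (λ x → 2 * ∣ N * f x - ∑ᶜ f ∣)
        ≡⟨ cong (q ^ n *_) (∑-*ˡ (allConfigs p n) 2 _) ⟩
      q ^ n * (2 * deviation f)
        ≡⟨ *-exchange (q ^ n) 2 _ ⟩
      2 * (q ^ n * deviation f)
        ≤⟨ *-monoʳ-≤ 2 (poincaré f) ⟩
      2 * (K * (N * N) * energy f)
        ≡⟨ rearrange K N (energy f) ⟩
      N * (2 * K * N * energy f)
        ≡⟨ cong (λ b → N * (2 * K * N * b)) (boundarySize≡energy S∈) ⟨
      N * (2 * K * N * boundarySize p n S) ∎)
      where
      open ≤-Reasoning
      N = p ^ n
      K = poincaré-constant
      f : Config p n → ℕ
      f = indicator S
      N≢0 : NonZero N
      N≢0 = m^n≢0 p n {{subst NonZero (sym p≡2+q) _}}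
      rearrange : ∀ k n e → 2 * (k * (n * n) * e) ≡ n * (2 * k * n * e)
      rearrange = solve-∀
      small′ : 2 * ∑ᶜ f ≤ N
      small′ = subst (λ s → 2 * s ≤ N) (length≡∑-indicator S∈) small
      s+s≤N : ∑ᶜ f + ∑ᶜ f ≤ N
      s+s≤N = subst (_≤ N) (cong (∑ᶜ f +_) (+-identityʳ _)) small′
      far : ∀ b → N * 𝟙 b ≤ 2 * ∣ N * 𝟙 b - ∑ᶜ f ∣
      far false = ≤-trans (≤-reflexive (*-zeroʳ N)) z≤n
      far true  = begin
        N * 1                       ≡⟨ *-identityʳ N ⟩
        N                           ≡⟨ m+[n∸m]≡n (≤-trans (m≤m+n s s) s+s≤N) ⟨
        -- The bound |S| ≤ |V|/2 enters here, as s ≤ N ∸ s.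
        s + (N ∸ s)                 ≤⟨ +-monoˡ-≤ (N ∸ s) (m+n≤o⇒m≤o∸n s s+s≤N) ⟩
        (N ∸ s) + (N ∸ s)           ≡⟨ cong (N ∸ s +_) (+-identityʳ _) ⟨
        2 * (N ∸ s)                 ≤⟨ *-monoʳ-≤ 2 (m∸n≤∣m-n∣ N s) ⟩
        2 * ∣ N - s ∣               ≡⟨ cong (λ m → 2 * ∣ m - s ∣) (*-identityʳ N) ⟨
        2 * ∣ N * 1 - s ∣           ∎
        where s = ∑ᶜ f

    -- Each of the n discs chooses freely among q pegs. This is the size of the matching formed by
    -- the moves of a larger disc between c and d.
    W-1 : {c d : Fin p} → c ≢ d → ∀ n → W {n = n} c d (λ _ → 1) ≡ q ^ n
    W-1 c≢d zero = refl
    W-1 {c} {d} c≢d (suc n) = begin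
      W {n = suc n} c d (λ _ → 1)
        ≡⟨ W-∷ʳ {n = n} c d (λ _ → 1) ⟩
      ∑ᶠ (λ a → 𝟙 (other c d a) * W {n = n} c d (λ _ → 1))
        ≡⟨ ∑-*ʳ (allFin p) _ (λ a → 𝟙 (other c d a)) ⟩
      ∑ᶠ (λ a → 𝟙 (other c d a)) * W {n = n} c d (λ _ → 1)
        ≡⟨ cong₂ _*_ (∑-other≡q c≢d) (W-1 c≢d n) ⟩
      q ^ suc n ∎
      where open ≡-Reasoning

    -- The cut for the upper bound

    module LargestDiscOn (i : Fin p) (n : ℕ) where

      largestOn : Config p (suc n) → Bool
      largestOn v = last v ==ᶠ i

      cut : List (Config p (suc n))
      cut = filterᵇ largestOn (allConfigs p (suc n))

      cut∈ : cut ∈ sublists (allConfigs p (suc n))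
      cut∈ = filterᵇ-∈-sublists largestOn (allConfigs p (suc n))

      -- Constancy on every slice makes all slice energies vanish, so that only moves of the largest
      -- disc cross the cut.
      slice-indicator : ∀ c x → slice c (indicator cut) x ≡ 𝟙 (c ==ᶠ i)
      slice-indicator c x = cong 𝟙 (trans (memᶜ-filterᵇ largestOn (x ∷ʳ c)) (cong (_==ᶠ i) (Vec.last-∷ʳ c x)))

      length-cut : length cut ≡ p ^ n
      length-cut = begin
        length cut
          ≡⟨ trans (length≡∑-indicator cut∈) (∑ᶜ-∷ʳ (indicator cut)) ⟩
        ∑ᶠ (λ c → ∑ᶜ (slice c (indicator cut)))
          ≡⟨ ∑-cong (allFin p) (λ c → trans (∑-cong (allConfigs p n) (slice-indicator c)) (trans (∑ᶜ-const n _) (*-comm (p ^ n) _))) ⟩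
        ∑ᶠ (λ c → 𝟙 (c ==ᶠ i) * p ^ n)
          ≡⟨ ∑ᶠ-δ i (λ _ → p ^ n) ⟩
        p ^ n ∎
        where open ≡-Reasoning

      boundarySize-cut : boundarySize p (suc n) cut ≤ p * q ^ n
      boundarySize-cut = begin
        boundarySize p (suc n) cut
          ≡⟨ trans (boundarySize≡energy cut∈) (energy-∷ʳ f) ⟩
        ∑ᶠ (λ c → energy (slice c f)) + cross f
          ≡⟨ cong (_+ cross f) (trans (∑-cong (allFin p) flat) (∑-0 (allFin p))) ⟩
        cross f
          -- A drop requires c = i; each of the p values of d is then charged a whole matching of
          -- size qⁿ.
          ≤⟨ ∑-mono (allFin p) (λ c → ∑-mono (allFin p) (bundle≤ c)) ⟩
        ∑ᶠ (λ c → ∑ᶠ {p} (λ _ → 𝟙 (c ==ᶠ i) * q ^ n))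
          ≡⟨ ∑-cong (allFin p) (λ c → trans (∑ᶠ-const p _) (*-exchange p (𝟙 (c ==ᶠ i)) (q ^ n))) ⟩
        ∑ᶠ (λ c → 𝟙 (c ==ᶠ i) * (p * q ^ n))
          ≡⟨ ∑ᶠ-δ i (λ _ → p * q ^ n) ⟩
        p * q ^ n ∎
        where
        open ≤-Reasoning
        f : Config p (suc n) → ℕ
        f = indicator cut
        flat : ∀ c → energy (slice c f) ≡ 0
        flat c = trans (∑-cong (allConfigs p n) (λ u → trans (∑-cong (allConfigs p n) (λ v →
          trans (cong (𝟙 (adj u v) *_) (trans (cong₂ _∸_ (slice-indicator c u) (slice-indicator c v)) (n∸n≡0 (𝟙 (c ==ᶠ i))))) (*-zeroʳ (𝟙 (adj u v)))))
          (∑-0 (allConfigs p n)))) (∑-0 (allConfigs p n))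
        bundle≤ : ∀ c d → bundle f c d ≤ 𝟙 (c ==ᶠ i) * q ^ n
        bundle≤ c d with c Fin.≟ d
        ... | yes _ = z≤n
        ... | no c≢d = begin
          1 * ∑ᶜ (λ x → 𝟙 (avoid c d x) * (slice c f x ∸ slice d f x))
            ≡⟨ *-identityˡ _ ⟩
          ∑ᶜ (λ x → 𝟙 (avoid c d x) * (slice c f x ∸ slice d f x))
            ≤⟨ ∑-mono (allConfigs p n) (λ x → *-monoʳ-≤ (𝟙 (avoid c d x)) (≤-trans (m∸n≤m _ (slice d f x)) (≤-reflexive (slice-indicator c x)))) ⟩
          ∑ᶜ {n = n} (λ x → 𝟙 (avoid c d x) * 𝟙 (c ==ᶠ i))
            ≡⟨ ∑-*ʳ (allConfigs p n) (𝟙 (c ==ᶠ i)) (𝟙 ∘ avoid c d) ⟩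
          ∑ᶜ {n = n} (𝟙 ∘ avoid c d) * 𝟙 (c ==ᶠ i)
            ≡⟨ cong (_* 𝟙 (c ==ᶠ i)) (trans (∑-cong (allConfigs p n) (λ x → sym (*-identityʳ (𝟙 (avoid c d x))))) (W-1 c≢d n)) ⟩
          q ^ n * 𝟙 (c ==ᶠ i)
            ≡⟨ *-comm (q ^ n) _ ⟩
          𝟙 (c ==ᶠ i) * q ^ n ∎

open Energy

-- Rational arithmetic

open import Data.Integer as ℤ using (+_)
import Data.Integer.Properties as ℤ
open import Data.Rational using (ℚ; 0ℚ; _*_; _/_; _⊓_; toℚᵘ) renaming (_<_ to _<ℚ_; _≤_ to _≤ℚ_)
import Data.Rational.Properties as ℚ
import Data.Rational.Unnormalised as ℚᵘ
import Data.Rational.Unnormalised.Properties as ℚᵘ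

-- `ℚ` stores reduced fractions, so products and cross-multiplication are carried out in `ℚᵘ`, where
-- numerator and denominator are kept as given.
toℚᵘ-/ : ∀ a b .{{_ : ℕ.NonZero b}} → toℚᵘ (+ a / b) ℚᵘ.≃ (+ a ℚᵘ./ b)
toℚᵘ-/ a (suc b) = ℚ.toℚᵘ-fromℚᵘ (+ a ℚᵘ./ suc b)

/-≤ : ∀ a b c d .{{_ : ℕ.NonZero b}} .{{_ : ℕ.NonZero d}} → a ℕ.* d ≤ c ℕ.* b → + a / b ≤ℚ + c / d
/-≤ a b@(suc _) c d@(suc _) le = ℚ.toℚᵘ-cancel-≤
  (ℚᵘ.≤-respˡ-≃ (ℚᵘ.≃-sym (toℚᵘ-/ a b)) (ℚᵘ.≤-respʳ-≃ (ℚᵘ.≃-sym (toℚᵘ-/ c d))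
    (ℚᵘ.*≤* (subst₂ ℤ._≤_ (ℤ.pos-* a d) (ℤ.pos-* c b) (ℤ.+≤+ le)))))

/-* : ∀ a b c d .{{_ : ℕ.NonZero b}} .{{_ : ℕ.NonZero d}} .{{_ : ℕ.NonZero (b ℕ.* d)}} →
      (+ a / b) * (+ c / d) ≡ + (a ℕ.* c) / (b ℕ.* d)
/-* a b@(suc _) c d@(suc _) = ℚ.toℚᵘ-injective (begin-equality
  toℚᵘ ((+ a / b) * (+ c / d))             ≃⟨ ℚ.toℚᵘ-homo-* (+ a / b) (+ c / d) ⟩
  toℚᵘ (+ a / b) ℚᵘ.* toℚᵘ (+ c / d)       ≃⟨ ℚᵘ.*-cong (toℚᵘ-/ a b) (toℚᵘ-/ c d) ⟩
  (+ a ℚᵘ./ b) ℚᵘ.* (+ c ℚᵘ./ d)           ≡⟨ cong (ℚᵘ._/ (b ℕ.* d)) (sym (ℤ.pos-* a c)) ⟩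
  + (a ℕ.* c) ℚᵘ./ (b ℕ.* d)               ≃⟨ toℚᵘ-/ (a ℕ.* c) (b ℕ.* d) ⟨
  toℚᵘ (+ (a ℕ.* c) / (b ℕ.* d))           ∎)
  where open ℚᵘ.≤-Reasoning

/-^ : ∀ a b .{{_ : ℕ.NonZero b}} n .{{_ : ℕ.NonZero (b ℕ.^ n)}} → (+ a / b) ^ℚ n ≡ + (a ℕ.^ n) / (b ℕ.^ n)
/-^ a b zero = refl
/-^ a b (suc n) = trans (cong ((+ a / b) *_) (/-^ a b n)) (/-* a b (a ℕ.^ n) (b ℕ.^ n))
  where
  instance
    bⁿ≢0 : ℕ.NonZero (b ℕ.^ n)
    bⁿ≢0 = ℕ.m^n≢0 b n

0</ : ∀ a b .{{_ : ℕ.NonZero a}} .{{_ : ℕ.NonZero b}} → 0ℚ <ℚ + a / b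
0</ a@(suc _) b@(suc _) = ℚ.positive⁻¹ (+ a / b) {{ℚ.normalize-pos a b}}

ratio≡/ : ∀ b s .{{_ : ℕ.NonZero s}} → ratio b s ≡ + b / s
ratio≡/ b (suc s) = refl

-- The head of the list is the seed of the fold and sits innermost, so `go` keeps it fixed while
-- shortening the tail.
minList≤ : ∀ e {x} xs → x ∈ xs → minList e xs ≤ℚ x
minList≤ e (y ∷ ys) x∈ = go y ys x∈
  where
  go : ∀ y ys {x} → x ∈ y ∷ ys → foldr _⊓_ y ys ≤ℚ x
  go y []       (here refl)         = ℚ.≤-refl
  go y (z ∷ zs) (here refl)         = ℚ.≤-trans (ℚ.p⊓q≤q z _) (go y zs (here refl))
  go y (z ∷ zs) (there (here refl)) = ℚ.p⊓q≤p z _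
  go y (z ∷ zs) (there (there x∈))  = ℚ.≤-trans (ℚ.p⊓q≤q z _) (go y zs (there x∈))

-- The member x guarantees a nonempty list; on the empty list the value would be the default e,
-- about which `bound` says nothing.
≤minList : ∀ e {l x} xs → x ∈ xs → (∀ {y} → y ∈ xs → l ≤ℚ y) → l ≤ℚ minList e xs
≤minList e {l} (y ∷ ys) _ bound = go ys (bound (here refl)) (bound ∘ there)
  where
  go : ∀ zs → l ≤ℚ y → (∀ {z} → z ∈ zs → l ≤ℚ z) → l ≤ℚ foldr _⊓_ y zs
  go []       l≤y h = l≤y
  go (z ∷ zs) l≤y h = ℚ.⊓-glb (h (here refl)) (go zs l≤y (h ∘ there))

-- Bounds on the edge expansion

admissible : ∀ p n → List (Config p n) → Bool
admissible p n S = ⌊ 0 ℕ.<? length S ⌋ ∧ ⌊ 2 ℕ.* length S ℕ.≤? p ℕ.^ n ⌋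

-- By definition `edgeExpansion p n` is `minList 0ℚ (quotients p n)`.
quotients : ∀ p n → List ℚ
quotients p n = map (λ S → ratio (boundarySize p n S) (length S)) (filterᵇ (admissible p n) (sublists (allConfigs p n)))

module _ (r : ℕ) where
  private
    -- In successor form `base p` computes to q / p, and the denominators are visibly nonzero.
    q = 1 ℕ.+ r
    p = 2 ℕ.+ q
  open Means p q refl
  open Isoperimetry p q refl

  isoConstant : ℕ
  isoConstant = 2 ℕ.* poincaré-constant

  -- The cut has pᵐ of the p pᵐ vertices, which is at most half since p ≥ 2.
  cut∈quotients : ∀ m → let open LargestDiscOn zero m in
                  ratio (boundarySize p (suc m) cut) (length cut) ∈ quotients p (suc m)
  cut∈quotients m = ∈-map⁺ _ (∈-filter⁺ (T? ∘ admissible p (suc m)) cut∈ (Equivalence.from (T-∧ {⌊ 0 ℕ.<? length cut ⌋})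
    ( fromWitness {a? = 0 ℕ.<? length cut} (subst (0 ℕ.<_) (sym length-cut) (ℕ.m^n>0 p m))
    , fromWitness {a? = 2 ℕ.* length cut ℕ.≤? p ℕ.^ suc m} (subst (λ s → 2 ℕ.* s ≤ p ℕ.^ suc m) (sym length-cut) (ℕ.*-monoˡ-≤ (p ℕ.^ m) {2} {p} (s≤s (s≤s z≤n)))))))
    where open LargestDiscOn zero m

  edgeExpansion-lower : ∀ m → (+ 1 / isoConstant) * (base p ^ℚ suc m) ≤ℚ edgeExpansion p (suc m)
  edgeExpansion-lower m = ≤minList 0ℚ (quotients p (suc m)) (cut∈quotients m) bound
    where
    n = suc m
    instance
      pⁿ≢0 : ℕ.NonZero (p ℕ.^ n)
      pⁿ≢0 = ℕ.m^n≢0 p n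
      isoConstant*pⁿ≢0 : ℕ.NonZero (isoConstant ℕ.* p ℕ.^ n)
      isoConstant*pⁿ≢0 = ℕ.m*n≢0 isoConstant (p ℕ.^ n)
    bound : ∀ {y} → y ∈ quotients p n → (+ 1 / isoConstant) * (base p ^ℚ n) ≤ℚ y
    bound y∈ with ∈-map⁻ _ y∈
    ... | S , S∈ , refl with ∈-filter⁻ (T? ∘ admissible p n) {xs = sublists (allConfigs p n)} S∈
    ... | S∈ , adm with Equivalence.to (T-∧ {⌊ 0 ℕ.<? length S ⌋}) adm
    ... | nonempty , small = begin
      (+ 1 / isoConstant) * (base p ^ℚ n)                   ≡⟨ cong ((+ 1 / isoConstant) *_) (/-^ q p n) ⟩
      (+ 1 / isoConstant) * (+ (q ℕ.^ n) / (p ℕ.^ n))       ≡⟨ /-* 1 isoConstant (q ℕ.^ n) (p ℕ.^ n) ⟩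
      + (1 ℕ.* q ℕ.^ n) / (isoConstant ℕ.* p ℕ.^ n)         ≤⟨ /-≤ (1 ℕ.* q ℕ.^ n) (isoConstant ℕ.* p ℕ.^ n) b s ineq ⟩
      + b / s                                               ≡⟨ ratio≡/ b s ⟨
      ratio b s                                             ∎
      where
      open ℚ.≤-Reasoning
      b = boundarySize p n S
      s = length S
      instance
        s≢0 : ℕ.NonZero s
        s≢0 = ℕ.>-nonZero (toWitness {a? = 0 ℕ.<? length S} nonempty)
      ineq : 1 ℕ.* q ℕ.^ n ℕ.* s ≤ b ℕ.* (isoConstant ℕ.* p ℕ.^ n)
      ineq = subst₂ _≤_ (cong (ℕ._* s) (sym (ℕ.*-identityˡ (q ℕ.^ n)))) (ℕ.*-comm (isoConstant ℕ.* p ℕ.^ n) b)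
        (isoperimetric S∈ (toWitness {a? = 2 ℕ.* length S ℕ.≤? p ℕ.^ n} small))

  edgeExpansion-upper : ∀ m → edgeExpansion p (suc m) ≤ℚ (+ (p ℕ.* p) / 1) * (base p ^ℚ suc m)
  edgeExpansion-upper m = begin
    edgeExpansion p n                               ≤⟨ minList≤ 0ℚ (quotients p n) (cut∈quotients m) ⟩
    ratio b (length cut)                            ≡⟨ cong (ratio b) length-cut ⟩
    ratio b (p ℕ.^ m)                               ≡⟨ ratio≡/ b (p ℕ.^ m) ⟩
    + b / (p ℕ.^ m)                                 ≤⟨ /-≤ b (p ℕ.^ m) (p ℕ.* p ℕ.* q ℕ.^ n) (1 ℕ.* p ℕ.^ n) ineq ⟩
    + (p ℕ.* p ℕ.* q ℕ.^ n) / (1 ℕ.* p ℕ.^ n)       ≡⟨ /-* (p ℕ.* p) 1 (q ℕ.^ n) (p ℕ.^ n) ⟨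
    (+ (p ℕ.* p) / 1) * (+ (q ℕ.^ n) / (p ℕ.^ n))   ≡⟨ cong ((+ (p ℕ.* p) / 1) *_) (/-^ q p n) ⟨
    (+ (p ℕ.* p) / 1) * (base p ^ℚ n)               ∎
    where
    open LargestDiscOn zero m
    open ℚ.≤-Reasoning
    n = suc m
    b = boundarySize p n cut
    instance
      pᵐ≢0 : ℕ.NonZero (p ℕ.^ m)
      pᵐ≢0 = ℕ.m^n≢0 p m
      pⁿ≢0 : ℕ.NonZero (p ℕ.^ n)
      pⁿ≢0 = ℕ.m^n≢0 p n
      1*pⁿ≢0 : ℕ.NonZero (1 ℕ.* p ℕ.^ n)
      1*pⁿ≢0 = ℕ.m*n≢0 1 (p ℕ.^ n)
    rearrange : ∀ p q Q N → p ℕ.* (q ℕ.* Q) ℕ.* (1 ℕ.* (p ℕ.* N)) ≡ p ℕ.* p ℕ.* (q ℕ.* Q) ℕ.* N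
    rearrange = solve-∀
    ineq : b ℕ.* (1 ℕ.* p ℕ.^ n) ≤ p ℕ.* p ℕ.* q ℕ.^ n ℕ.* p ℕ.^ m
    ineq = ℕ.≤-trans
      -- The cut gives p qᵐ / pᵐ = p² qᵐ / pᵐ⁺¹, whence the constant p²; since q ≥ 1, that is p ≥ 3,
      -- qᵐ may be raised to qᵐ⁺¹.
      (ℕ.*-monoˡ-≤ (1 ℕ.* p ℕ.^ n) (ℕ.≤-trans boundarySize-cut (ℕ.*-monoʳ-≤ p (ℕ.m≤n*m (q ℕ.^ m) q))))
      (ℕ.≤-reflexive (rearrange p q (q ℕ.^ m) (p ℕ.^ m)))

theorem1 : (p : ℕ) → 3 ≤ p →
    Σ ℚ λ c₁ → Σ ℚ λ c₂ → Σ ℕ λ N →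
    (0ℚ <ℚ c₁) × (0ℚ <ℚ c₂) ×
    ((n : ℕ) → N ≤ n →
    (c₁ * (base p ^ℚ n) ≤ℚ edgeExpansion p n)
    × (edgeExpansion p n ≤ℚ c₂ * (base p ^ℚ n)))
theorem1 (suc (suc (suc r))) (s≤s (s≤s (s≤s _))) =
  -- The threshold is 1: for n = 0 no set is admissible and `edgeExpansion` is the dummy 0, while
  -- the zeroth power of `base p` is 1, so no positive c₁ would do.
  + 1 / isoConstant r , + ((3 ℕ.+ r) ℕ.* (3 ℕ.+ r)) / 1 , 1 , 0</ 1 (isoConstant r) , 0</ ((3 ℕ.+ r) ℕ.* (3 ℕ.+ r)) 1 ,
  λ { (suc m) _ → edgeExpansion-lower r m , edgeExpansion-upper r m }
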